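{- For every prime number $p$, $3\le \operatorname{aw}(\mathbb{Z}_p,3)\le 4$. For every integer $n\ge 2$, \[\operatorname{aw}(\mathbb{Z}_n,3) = 2+f_2(n)+f_3(n)+2f_4(n).\] Moreover, for an integer $n\ge 2$ all of whose prime factors are less than $100$, $f_4(n)$ equals the number of odd prime factors of $n$ (counted with multiplicity) lying in $Q_4:=\{17, 31, 41, 43, 73, 89, 97\}$, and $f_3(n)$ equals the number of odd prime factors of $n$ (counted with multiplicity) lying in $Q_3$, the set of all odd primes less than $100$ not in $Q_4$.
   Context: $\mathbb{Z}_n$ is the cyclic group of integers modulo $n$. For a subset $S$ of $\mathbb{Z}_n$ and $k\ge 2$, a $k$-term arithmetic progression ($k$-AP) is a set of $k$ distinct elements of the form $a,a+d,\dots,a+(k-1)d$ (computed mod $n$) with $d\not\equiv 0$. An $r$-coloring of $S$ is a function $c:S\to\{1,\dots,r\}$; it is exact if surjective. A $k$-AP is rainbow if its elements receive $k$ distinct colors. $\operatorname{aw}(S,k)$ is the smallest $r$ such that every exact $r$-coloring of $S$ contains a rainbow $k$-AP (with $\operatorname{aw}(S,k)=|S|+1$ if $|S|<k$). For an integer $n\ge 2$: $f_2(n)=0$ if $n$ is odd and $1$ if $n$ is even; $f_3(n)$ is the number of odd prime factors $p$ of $n$ with $\operatorname{aw}(\mathbb{Z}_p,3)=3$, and $f_4(n)$ the number of odd prime factors $p$ of $n$ with $\operatorname{aw}(\mathbb{Z}_p,3)=4$, both counted with multiplicity. -}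

module Defs where

open import Data.Nat using (ℕ; zero; suc; _+_; _*_; _≤_; _<_)
open import Data.Nat.DivMod using (_mod_)
open import Data.Nat.Divisibility using (_∣_; _∣?_)
open import Data.Nat.Primality using (Prime)
open import Data.Fin using (Fin; toℕ)
open import Data.List using (List; []; _∷_)
open import Data.List.Membership.Propositional using (_∈_; _∉_)
open import Data.Product using (_×_; ∃; ∃-syntax)
open import Data.Empty using (⊥)
open import Relation.Nullary using (¬_; yes; no)
open import Relation.Binary.PropositionalEquality using (_≡_; _≢_)

-- The cyclic group Z_n for n = suc m is represented by Fin (suc m);
-- the k-th term a + k·d (mod n) of an arithmetic progression:

term : ∀ {m} → Fin (suc m) → Fin (suc m) → ℕ → Fin (suc m)
term {m} a d k = (toℕ a + k * toℕ d) mod (suc m)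

Exact : ∀ {n r} → (Fin n → Fin r) → Set
Exact {n} {r} c = ∀ (j : Fin r) → ∃[ i ] (c i ≡ j)

Rainbow3AP : ∀ {m r} → (Fin (suc m) → Fin r) → Set
Rainbow3AP c =
  ∃[ a ] ∃[ d ] (toℕ d ≢ 0 ×
    (term a d 0 ≢ term a d 1 × term a d 0 ≢ term a d 2 × term a d 1 ≢ term a d 2) ×
    (c (term a d 0) ≢ c (term a d 1) × c (term a d 0) ≢ c (term a d 2) ×
     c (term a d 1) ≢ c (term a d 2)))

AllRainbow : ℕ → ℕ → Set
AllRainbow m r = (c : Fin (suc m) → Fin r) → Exact c → Rainbow3AP c

-- AW n v : "aw(Z_n, 3) = v", i.e. v is the smallest number r ≥ 1 of colors
-- such that every exact r-coloring of Z_n contains a rainbow 3-AP.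
-- (Z_0 is not considered; AW 0 v is defined as ⊥.)
AW : ℕ → ℕ → Set
AW zero    v = ⊥
AW (suc m) v = 1 ≤ v × AllRainbow m v × (∀ r → 1 ≤ r → r < v → ¬ AllRainbow m r)

f₂ : ℕ → ℕ
f₂ n with 2 ∣? n
... | yes _ = 1
... | no  _ = 0

data Count (P : ℕ → Set) : List ℕ → ℕ → Set where
  c-nil  : Count P [] 0
  c-yes  : ∀ {x xs k} → P x → Count P xs k → Count P (x ∷ xs) (suc k)
  c-no   : ∀ {x xs k} → ¬ P x → Count P xs k → Count P (x ∷ xs) k

Odd : ℕ → Set
Odd p = ¬ (2 ∣ p)

OddAw : ℕ → ℕ → Set
OddAw v p = Odd p × AW p v

Q₄ : List ℕ
Q₄ = 17 ∷ 31 ∷ 41 ∷ 43 ∷ 73 ∷ 89 ∷ 97 ∷ []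

InQ₄ : ℕ → Set
InQ₄ p = Odd p × p ∈ Q₄

InQ₃ : ℕ → Set
InQ₃ p = Odd p × Prime p × p < 100 × p ∉ Q₄

{-# OPTIONS --safe #-}
module Submission where

-- A colouring of Z_n is an n-periodic map ℤ → ℕ, and aw(Z_n, 3) = v means that a colouring without
-- rainbow progressions has at most v − 1 colours, with equality attained.
--
-- Modulo a prime p, in such a colouring with at least three colours, every difference d ≢ 0 has a dominant
-- colour D(d): any x and x + d of different colours include one of colour D(d). This holds because the
-- gap between two consecutive elements of one colour starts and ends with the same colour. The midpoint of x and
-- x + 2d gives D(2d) = D(d), and D(−d) = D(d); moreover D is not constant, so there is a nonconstant
-- function on the nonzero residues invariant under −1 and 2. Conversely such a function, with 0 as a third
-- colour, is a rainbow-free colouring. With four colours D takes three values and D(x + y) ∈ {D(x), D(y)}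
-- whenever D(x) ≠ D(y); then every monochromatic progression of length ≥ 2, whose step has a different
-- value of D, can be prolonged, which is impossible modulo p.
--
-- For composite n, colourings of Z_t and of Z_p with 0 isolated combine to one of Z_pt. In the other
-- direction, for n = pt odd, some class M modulo p misses at most one colour of every other class, and
-- sending each class to its colour missing in M (or to a common new colour) is a rainbow-free colouring of Z_p.
-- For n = 2t, a colour α absent from the odd elements and a colour γ absent from the even ones, at minimal
-- distance N, occupy exactly a + 2Nℤ and a + N + 2Nℤ, so all other colours occur on even elements, and γ can be
-- put back on the even elements if t is even.

open import Defs
open import Data.Bool using (Bool; true; false; if_then_else_)
open import Data.Empty using (⊥; ⊥-elim)
open import Data.Fin using (Fin; toℕ; fromℕ<)
open import Data.Fin.Properties using (any?; all?; toℕ-fromℕ<; toℕ<n; toℕ-injective) renaming (_≟_ to _≟ᶠ_)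
open import Data.Fin.Subset using (Subset)
open import Data.Fin.Subset.Properties using (anySubset?)
open import Data.Integer using (ℤ; +_; -[1+_]; ∣_∣)
  renaming (_+_ to _+ᶻ_; _*_ to _*ᶻ_; _-_ to _-ᶻ_; -_ to -ᶻ_; _^_ to _^ᶻ_)
open import Data.Integer.DivMod using (_%ℕ_; _/ℕ_; a≡a%ℕn+[a/ℕn]*n; n%ℕd<d)
open import Data.Integer.Divisibility.Signed
  using (divides; ∣⇒∣ᵤ; ∣ᵤ⇒∣; ∣m∣n⇒∣m+n; ∣m∣n⇒∣m-n; ∣m⇒∣-m; ∣n⇒∣m*n; ∣m⇒∣m*n; ∣-refl; ∣-trans)
  renaming (_∣_ to _∣ᶻ_; _∣?_ to _∣ᶻ?_)
import Data.Integer.Properties as ℤₚ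
open import Data.Integer.Tactic.RingSolver using (solve-∀)
open import Data.List using (List; []; _∷_; length; filter; tabulate)
open import Data.List.Membership.Propositional using (_∈_; _∉_)
open import Data.List.Membership.Propositional.Properties using (∈-filter⁻)
open import Data.List.Properties using (filter-reject; filter-accept; length-tabulate)
open import Data.List.Relation.Unary.All as All using (All; []; _∷_)
import Data.List.Relation.Unary.All.Properties as Allₚ
open import Data.List.Relation.Unary.AllPairs as AllPairs using (AllPairs; []; _∷_)
import Data.List.Relation.Unary.AllPairs.Properties as AllPairsₚ
open import Data.List.Relation.Unary.Any using (Any; here; there; satisfied) renaming (any? to anyᴸ?)
open import Data.Nat
  using (ℕ; zero; suc; _+_; _*_; _^_; _∸_; _⊓_; _≤_; _<_; z≤n; s≤s; _≟_; _<?_; _≤?_; NonZero; ≢-nonZero; nonTrivial⇒≢1; nonTrivial⇒n>1)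
open import Data.Nat.Coprimality using (Coprime; coprime-Bézout)
open import Data.Nat.DivMod using (_%_; _/_; _mod_; m≡m%n+[m/n]*n; m%n<n)
import Data.Nat.Divisibility as ℕ∣
open import Data.Nat.GCD using (module Bézout)
open import Data.Nat.Induction using (<-rec)
open import Data.Nat.ListAction using (product)
open import Data.Nat.Primality using (Prime; prime?; prime⇒irreducible; prime⇒nonZero; prime⇒nonTrivial; euclidsLemma)
open import Data.Nat.Primality.Factorisation using (PrimeFactorisation; factors)
import Data.Nat.Properties as ℕₚ
open import Data.List.Membership.DecPropositional ℕₚ._≟_ using (_∈?_)
open import Data.Nat.Tactic.RingSolver renaming (solve-∀ to solve-ℕ)
open import Data.Product using (_×_; _,_; ∃-syntax; proj₁; proj₂)
open import Data.Sum using (_⊎_; inj₁; inj₂)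
open import Data.Vec using (lookup)
import Data.Vec as Vec
open import Data.Vec.Properties using (lookup∘tabulate)
open import Function using (_∘_)
open import Relation.Binary.Definitions using (tri<; tri≈; tri>)
open import Relation.Binary.PropositionalEquality using (_≡_; _≢_; refl; sym; trans; cong; cong₂; subst; subst₂)
open import Relation.Nullary using (¬_; Dec; yes; no; does; contradiction)
open import Relation.Nullary.Decidable using (_×-dec_; _⊎-dec_; ¬?; map′; from-yes)
open import Relation.Unary using (Decidable)

-- Rainbow-free colourings of the integers

Coincide : ℕ → ℕ → ℕ → Set
Coincide a b c = a ≡ b ⊎ a ≡ c ⊎ b ≡ c

-- Progressions of Z_n lift to ℤ, so for an n-periodic colouring this is the condition modulo n.
-- Degenerate triples, also those that collapse only modulo n, satisfy it by themselves.
RainbowFree : (ℤ → ℕ) → Set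
RainbowFree c = ∀ x y z → x +ᶻ z ≡ y +ᶻ y → Coincide (c x) (c y) (c z)

coincide-ends : ∀ {a b c} → a ≢ b → b ≢ c → Coincide a b c → a ≡ c
coincide-ends a≢b b≢c (inj₁ p)        = contradiction p a≢b
coincide-ends a≢b b≢c (inj₂ (inj₁ p)) = p
coincide-ends a≢b b≢c (inj₂ (inj₂ p)) = contradiction p b≢c

coincide-last : ∀ {a b c} → a ≢ b → a ≢ c → Coincide a b c → b ≡ c
coincide-last a≢b a≢c (inj₁ p)        = contradiction p a≢b
coincide-last a≢b a≢c (inj₂ (inj₁ p)) = contradiction p a≢c
coincide-last a≢b a≢c (inj₂ (inj₂ p)) = p

coincide-first : ∀ {a b c} → a ≢ c → b ≢ c → Coincide a b c → a ≡ b
coincide-first a≢c b≢c (inj₁ p)        = p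
coincide-first a≢c b≢c (inj₂ (inj₁ p)) = contradiction p a≢c
coincide-first a≢c b≢c (inj₂ (inj₂ p)) = contradiction p b≢c

coincide-map : ∀ (f : ℕ → ℕ) {a b c} → Coincide a b c → Coincide (f a) (f b) (f c)
coincide-map f (inj₁ p)        = inj₁ (cong f p)
coincide-map f (inj₂ (inj₁ p)) = inj₂ (inj₁ (cong f p))
coincide-map f (inj₂ (inj₂ p)) = inj₂ (inj₂ (cong f p))

rainbowFree-map : ∀ (f : ℕ → ℕ) {c} → RainbowFree c → RainbowFree (f ∘ c)
rainbowFree-map f rf x y z e = coincide-map f (rf x y z e)

-- Integer multiplication unfolds to signs and absolute values, hence the abstract barrier.
abstract
  affine : ℤ → ℤ → ℤ → ℤ
  affine a d i = a +ᶻ i *ᶻ d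

  affine-def : ∀ a d i → affine a d i ≡ a +ᶻ i *ᶻ d
  affine-def a d i = refl

  affine-zero : ∀ a d → affine a d (+ 0) ≡ a
  affine-zero a d = ℤₚ.+-identityʳ a

  affine-suc : ∀ a d l → affine a d (+ l) +ᶻ d ≡ affine a d (+ suc l)
  affine-suc a d l = lemma a (+ l) d
    where
    lemma : ∀ x l d → (x +ᶻ l *ᶻ d) +ᶻ d ≡ x +ᶻ (+ 1 +ᶻ l) *ᶻ d
    lemma = solve-∀

  affine-shift : ∀ a d z i → affine (a +ᶻ z) d i ≡ affine a d i +ᶻ z
  affine-shift = lemma
    where
    lemma : ∀ a d z i → (a +ᶻ z) +ᶻ i *ᶻ d ≡ (a +ᶻ i *ᶻ d) +ᶻ z
    lemma = solve-∀

  affine-mid : ∀ a d {x y z} → x +ᶻ z ≡ y +ᶻ y → affine a d x +ᶻ affine a d z ≡ affine a d y +ᶻ affine a d y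
  affine-mid a d {x} {y} {z} e = trans (lemma₁ a d x z) (trans (cong (λ w → a +ᶻ a +ᶻ w *ᶻ d) e) (lemma₂ a d y))
    where
    lemma₁ : ∀ a d x z → (a +ᶻ x *ᶻ d) +ᶻ (a +ᶻ z *ᶻ d) ≡ a +ᶻ a +ᶻ (x +ᶻ z) *ᶻ d
    lemma₁ = solve-∀
    lemma₂ : ∀ a d y → a +ᶻ a +ᶻ (y +ᶻ y) *ᶻ d ≡ (a +ᶻ y *ᶻ d) +ᶻ (a +ᶻ y *ᶻ d)
    lemma₂ = solve-∀

rainbowFree-affine : ∀ a d {c} → RainbowFree c → RainbowFree (λ x → c (affine a d x))
rainbowFree-affine a d rf x y z e = rf _ _ _ (affine-mid a d e)

-- Gaps between consecutive elements of one colour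

data Parity : ℕ → Set where
  twice : ∀ w → Parity (w + w)
  twice+1 : ∀ w → Parity (suc (w + w))

parity : ∀ n → Parity n
parity zero = twice 0
parity (suc n) with parity n
... | twice w = twice+1 w
... | twice+1 w  = subst Parity (cong suc (ℕₚ.+-suc w w)) (twice (suc w))

module Gap (s : ℤ → ℕ) (rf : RainbowFree s) (M : ℕ) (closed : s (+ 0) ≡ s (+ M))
           (gap : ∀ i → 1 ≤ i → i < M → s (+ i) ≢ s (+ 0)) where

  double : ∀ e → 1 ≤ e → e + e < M → s (+ e) ≡ s (+ (e + e))
  double e 1≤e e<M = coincide-last
    (λ p → gap e 1≤e (ℕₚ.≤-<-trans (ℕₚ.m≤m+n e e) e<M) (sym p))
    (λ p → gap (e + e) (ℕₚ.≤-trans 1≤e (ℕₚ.m≤m+n e e)) e<M (sym p))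
    (rf (+ 0) (+ e) (+ (e + e)) refl)

  -- The triple -1, 0, 1 splits the proof. If -1 has the colour of 0, the triples -1, v, 2v + 1 and
  -- `double` make the whole gap monochromatic. If -1 has the colour of 1, the triple -1, w + 1, M
  -- passes it on to w + 1, hence to M - 1 = 2(w + 1).
  odd-case : ∀ w → M ≡ suc (suc (suc (w + w))) → s (+ 1) ≡ s (+ suc (suc (w + w)))
  odd-case w refl = first (rf -[1+ 0 ] (+ 0) (+ 1) refl)
    where
    mid : s (+ suc w) ≡ s (+ suc (suc (w + w)))
    mid = trans (double (suc w) (s≤s z≤n) (s≤s (s≤s (ℕₚ.≤-reflexive (ℕₚ.+-suc w w)))))
                (cong (λ k → s (+ suc k)) (ℕₚ.+-suc w w))
    mid≢ : s (+ suc w) ≢ s (+ suc (suc (suc (w + w))))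
    mid≢ p = gap (suc w) (s≤s z≤n) (s≤s (s≤s (ℕₚ.≤-trans (ℕₚ.m≤m+n w w) (ℕₚ.n≤1+n _)))) (trans p (sym closed))
    rest : s -[1+ 0 ] ≡ s (+ 0) → ∀ n → 1 ≤ n → n < M → s (+ n) ≡ s (+ 1)
    rest q = <-rec _ step
      where
      step : ∀ n → (∀ {k} → k < n → 1 ≤ k → k < M → s (+ k) ≡ s (+ 1)) → 1 ≤ n → n < M → s (+ n) ≡ s (+ 1)
      step n rec 1≤n n<M with parity n
      ... | twice (suc v) = trans (sym (double (suc v) (s≤s z≤n) n<M))
              (rec (ℕₚ.m<m+n (suc v) (s≤s z≤n)) (s≤s z≤n) (ℕₚ.≤-<-trans (ℕₚ.m≤m+n (suc v) (suc v)) n<M))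
      ... | twice+1 zero     = refl
      ... | twice+1 (suc v)  = trans (sym (coincide-last
              (λ p → gap (suc v) (s≤s z≤n) v<M (trans (sym p) q))
              (λ p → gap n 1≤n n<M (trans (sym p) q))
              (rf -[1+ 0 ] (+ suc v) (+ n) refl)))
              (rec v<n (s≤s z≤n) v<M)
        where
        v<n : suc v < suc (suc v + suc v)
        v<n = s≤s (ℕₚ.m≤m+n (suc v) (suc v))
        v<M : suc v < M
        v<M = ℕₚ.<-trans v<n n<M
    first : Coincide (s -[1+ 0 ]) (s (+ 0)) (s (+ 1)) → s (+ 1) ≡ s (+ suc (suc (w + w)))
    first (inj₁ p) = sym (rest p (suc (suc (w + w))) (s≤s z≤n) ℕₚ.≤-refl)
    first (inj₂ (inj₂ p)) = contradiction (sym p) (gap 1 ℕₚ.≤-refl (s≤s (s≤s z≤n)))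
    first (inj₂ (inj₁ p)) with rf -[1+ 0 ] (+ suc w) (+ suc (suc (suc (w + w)))) (cong (λ k → + suc k) (sym (ℕₚ.+-suc w w)))
    ... | inj₁ r = trans (sym p) (trans r mid)
    ... | inj₂ (inj₁ r) = contradiction (trans (sym p) (trans r (sym closed))) (gap 1 ℕₚ.≤-refl (s≤s (s≤s z≤n)))
    ... | inj₂ (inj₂ r) = contradiction r mid≢

  -- As in the odd case, with -2 in place of -1. If -2 has the colour of 0, the triples -2, e, 2e +
  -- 2 give s(e) = s(2e + 2) = s(e + 1). If it has the colour of 2, the triple -2, w, M is used.
  -- From w, `mid` passes to 2w by doubling and to M - 1 by the triple 2w, M - 1, M.
  even-case : ∀ w → M ≡ suc (suc (w + w)) → s (+ 1) ≡ s (+ suc (w + w))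
  even-case zero refl = refl
  even-case w@(suc w₀) refl = first (rf -[1+ 1 ] (+ 0) (+ 2) refl)
    where
    w<M : w < M
    w<M = ℕₚ.≤-trans (s≤s (ℕₚ.m≤m+n w w)) (ℕₚ.n≤1+n _)
    2<M : 2 < M
    2<M = s≤s (s≤s (s≤s z≤n))
    mid : s (+ w) ≡ s (+ suc (w + w))
    mid = trans (double w (s≤s z≤n) (ℕₚ.n≤1+n _)) (coincide-first
            (λ p → gap (w + w) (s≤s z≤n) (ℕₚ.n≤1+n _) (trans p (sym closed)))
            (λ p → gap (suc (w + w)) (s≤s z≤n) ℕₚ.≤-refl (trans p (sym closed)))
            (rf (+ (w + w)) (+ suc (w + w)) (+ M) (cong +_ (ℕₚ.+-suc (w + w) (suc (w + w))))))
    mid≢ : s (+ w) ≢ s (+ M)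
    mid≢ p = gap w (s≤s z≤n) w<M (trans p (sym closed))
    rest : s -[1+ 1 ] ≡ s (+ 0) → ∀ e → 1 ≤ e → e ≤ w → s (+ 1) ≡ s (+ e)
    rest q (suc zero) _ _ = refl
    rest q (suc e@(suc _)) _ e<w = trans (rest q e (s≤s z≤n) (ℕₚ.<⇒≤ e<w)) (trans (coincide-last
        (λ p → gap e (s≤s z≤n) (ℕₚ.<-trans e<w w<M) (trans (sym p) q))
        (λ p → gap (suc (suc (e + e))) (s≤s z≤n) ee<M (trans (sym p) q))
        (rf -[1+ 1 ] (+ e) (+ suc (suc (e + e))) refl))
        (trans (cong (λ k → s (+ suc k)) (sym (ℕₚ.+-suc e e)))
        (sym (double (suc e) (s≤s z≤n) (subst (_< M) (cong suc (sym (ℕₚ.+-suc e e))) ee<M)))))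
      where
      ee<M : suc (suc (e + e)) < M
      ee<M = s≤s (s≤s (ℕₚ.+-mono-<-≤ e<w (ℕₚ.<⇒≤ e<w)))
    first : Coincide (s -[1+ 1 ]) (s (+ 0)) (s (+ 2)) → s (+ 1) ≡ s (+ suc (w + w))
    first (inj₁ p) = trans (rest p w (s≤s z≤n) ℕₚ.≤-refl) mid
    first (inj₂ (inj₂ p)) = contradiction (sym p) (gap 2 (s≤s z≤n) 2<M)
    first (inj₂ (inj₁ p)) with rf -[1+ 1 ] (+ w) (+ M) refl
    ... | inj₁ r = trans (double 1 ℕₚ.≤-refl 2<M) (trans (sym p) (trans r mid))
    ... | inj₂ (inj₁ r) = contradiction (trans (sym p) (trans r (sym closed))) (gap 2 (s≤s z≤n) 2<M)
    ... | inj₂ (inj₂ r) = contradiction r mid≢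

  gap-ends : ∀ k → M ≡ suc (suc k) → s (+ 1) ≡ s (+ suc k)
  gap-ends k e with parity k
  ... | twice w = even-case w e
  ... | twice+1 w  = odd-case w e

rainbowFree-shift : ∀ a {c} → RainbowFree c → RainbowFree (λ x → c (a +ᶻ x))
rainbowFree-shift a rf x y z e = rf _ _ _
  (trans (lemma₁ a x z) (trans (cong (a +ᶻ a +ᶻ_) e) (lemma₂ a y)))
  where
  lemma₁ : ∀ a x z → (a +ᶻ x) +ᶻ (a +ᶻ z) ≡ a +ᶻ a +ᶻ (x +ᶻ z)
  lemma₁ = solve-∀
  lemma₂ : ∀ a y → a +ᶻ a +ᶻ (y +ᶻ y) ≡ (a +ᶻ y) +ᶻ (a +ᶻ y)
  lemma₂ = solve-∀

-- Two adjacent elements of different colours include a dominant colour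

least : ∀ {P : ℕ → Set} → Decidable P → ∀ n → P n → ∃[ m ] (m ≤ n × P m × ∀ i → i < m → ¬ P i)
least P? n pn with P? 0
... | yes p0 = 0 , z≤n , p0 , λ _ ()
least P? zero pn | no ¬p0 = contradiction pn ¬p0
least {P} P? (suc n) pn | no ¬p0 with least (P? ∘ suc) n pn
... | m , m≤n , pm , below = suc m , s≤s m≤n , pm , λ { zero _ → ¬p0 ; (suc i) (s≤s i<m) → below i i<m }

greatest : ∀ {P : ℕ → Set} → Decidable P → ∀ {k} m → k ≤ m → P k →
  ∃[ q ] (k ≤ q × q ≤ m × P q × ∀ i → q < i → i ≤ m → ¬ P i)
greatest P? m k≤m pk with P? m
... | yes pm = m , k≤m , ℕₚ.≤-refl , pm , λ i m<i i≤m _ → ℕₚ.<⇒≱ m<i i≤m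
greatest P? zero z≤n pk | no ¬pm = contradiction pk ¬pm
greatest {P} P? {k} (suc m) k≤m pk | no ¬pm with ℕₚ.m≤n⇒m<n∨m≡n k≤m
... | inj₂ refl = contradiction pk ¬pm
... | inj₁ (s≤s k≤m′) with greatest P? m k≤m′ pk
... | q , k≤q , q≤m , pq , above = q , k≤q , ℕₚ.m≤n⇒m≤1+n q≤m , pq , above′
  where
  above′ : ∀ i → q < i → i ≤ suc m → ¬ P i
  above′ i q<i i≤m with ℕₚ.m≤n⇒m<n∨m≡n i≤m
  ... | inj₁ (s≤s i≤m′) = above i q<i i≤m′
  ... | inj₂ refl = ¬pm

leaves : ∀ (f : ℕ → ℕ) n → f n ≢ f 0 → ∃[ l ] (f l ≡ f 0 × f (suc l) ≢ f 0)
leaves f zero ne = contradiction refl ne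
leaves f (suc n) ne with f n ≟ f 0
... | yes e = n , e , ne
... | no ne′ = leaves f n ne′

merge : ℕ → ℕ → ℕ → ℕ
merge t r x with x ≟ t
... | yes _ = r
... | no _  = x

merge-at : ∀ t r → merge t r t ≡ r
merge-at t r with t ≟ t
... | yes _ = refl
... | no ¬p = contradiction refl ¬p

merge-off : ∀ {t} r {x} → x ≢ t → merge t r x ≡ x
merge-off {t} r {x} x≢t with x ≟ t
... | yes p = contradiction p x≢t
... | no _  = refl

merge-target : ∀ t r → merge t r r ≡ r
merge-target t r with r ≟ t
... | yes _ = refl
... | no _  = refl

Through : ℕ → ℕ → ℕ → Set
Through h a b = a ≡ b ⊎ a ≡ h ⊎ b ≡ h

two-valued : ∀ {p q a b h} → a ≡ p ⊎ a ≡ q → b ≡ p ⊎ b ≡ q → h ≡ p ⊎ h ≡ q → Through h a b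
two-valued (inj₁ refl) (inj₁ refl) _           = inj₁ refl
two-valued (inj₂ refl) (inj₂ refl) _           = inj₁ refl
two-valued (inj₁ refl) (inj₂ refl) (inj₁ refl) = inj₂ (inj₁ refl)
two-valued (inj₁ refl) (inj₂ refl) (inj₂ refl) = inj₂ (inj₂ refl)
two-valued (inj₂ refl) (inj₁ refl) (inj₁ refl) = inj₂ (inj₂ refl)
two-valued (inj₂ refl) (inj₁ refl) (inj₂ refl) = inj₂ (inj₁ refl)

through? : ∀ h a b → Dec (Through h a b)
through? h a b = (a ≟ b) ⊎-dec (a ≟ h) ⊎-dec (b ≟ h)

module Hub (s : ℤ → ℕ) (rf : RainbowFree s) (s0≢s1 : s (+ 0) ≢ s (+ 1))
           (j : ℕ) (j≢0 : s (+ suc j) ≢ s (+ 0)) (j≢1 : s (+ suc j) ≢ s (+ 1))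
           (before : ∀ i → i < suc j → s (+ i) ≡ s (+ 0) ⊎ s (+ i) ≡ s (+ 1)) where

  -- The only candidate: a dominant colour occurs in both pairs (0, 1) and (j, j + 1), and the third
  -- colour does not occur in the first.
  hub : ℕ
  hub = s (+ j)

  other : ∀ x → ∃[ k ] (k ≤ suc j × s (+ k) ≢ x × s (+ k) ≢ hub)
  other x with s (+ suc j) ≟ x | before j ℕₚ.≤-refl
  ... | no ne    | inj₁ p = suc j , ℕₚ.≤-refl , ne , λ q → j≢0 (trans q p)
  ... | no ne    | inj₂ p = suc j , ℕₚ.≤-refl , ne , λ q → j≢1 (trans q p)
  ... | yes refl | inj₁ p = 1 , s≤s z≤n , (λ q → j≢1 (sym q)) , λ q → s0≢s1 (sym (trans q p))
  ... | yes refl | inj₂ p = 0 , z≤n , (λ q → j≢0 (sym q)) , λ q → s0≢s1 (trans q p)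

  -- Strong induction: a violating pair (m, m + 1) beyond j forces an earlier violating pair (q, q +
  -- 1).
  through-hub : ∀ m → Through hub (s (+ m)) (s (+ suc m))
  through-hub = <-rec _ step
    where
    step : ∀ m → (∀ {k} → k < m → Through hub (s (+ k)) (s (+ suc k))) → Through hub (s (+ m)) (s (+ suc m))
    step m rec with ℕₚ.<-cmp m j
    ... | tri< m<j _ _ = two-valued (before m (ℕₚ.m<n⇒m<1+n m<j)) (before (suc m) (s≤s m<j)) (before j ℕₚ.≤-refl)
    ... | tri≈ _ refl _ = inj₂ (inj₁ refl)
    ... | tri> _ _ j<m with through? hub (s (+ m)) (s (+ suc m))
    ... | yes t = t
    ... | no ¬t with other (s (+ m))
    ... | k , k≤j , r≢x , r≢h
        with greatest {P = λ i → s (+ i) ≡ s (+ suc m) ⊎ s (+ i) ≡ s (+ k)}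
               (λ i → (s (+ i) ≟ s (+ suc m)) ⊎-dec (s (+ i) ≟ s (+ k))) m (ℕₚ.≤-trans k≤j j<m) (inj₂ refl)
    ... | q , _ , q≤m , sq , above with ℕₚ.m≤n⇒m<n∨m≡n q≤m
    ... | inj₂ refl = ⊥-elim (no-both sq)
      where
      no-both : s (+ m) ≡ s (+ suc m) ⊎ s (+ m) ≡ s (+ k) → ⊥
      no-both (inj₁ p) = ¬t (inj₁ p)
      no-both (inj₂ p) = r≢x (sym p)
    ... | inj₁ q<m = ⊥-elim (absurd sq (rec q<m))
      where
      -- Identifying the colour T at m + 1 with the colour R at k, no element strictly between
      -- q and m + 1 has colour R, so the gap between them starts and ends with the same colour.
      X T R : ℕ
      X = s (+ m)
      T = s (+ suc m)
      R = s (+ k)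
      d : ℕ
      d = m ∸ suc q
      m≡ : q + suc d ≡ m
      m≡ = trans (ℕₚ.+-suc q d) (ℕₚ.m+[n∸m]≡n q<m)
      s′ : ℤ → ℕ
      s′ x = merge T R (s (+ q +ᶻ x))
      s′0 : s′ (+ 0) ≡ R
      s′0 = trans (cong (λ i → merge T R (s (+ i))) (ℕₚ.+-identityʳ q)) (at sq)
        where
        at : s (+ q) ≡ T ⊎ s (+ q) ≡ R → merge T R (s (+ q)) ≡ R
        at (inj₁ p) = trans (cong (merge T R) p) (merge-at T R)
        at (inj₂ p) = trans (cong (merge T R) p) (merge-target T R)
      inside : ∀ i → 1 ≤ i → i < suc (suc d) → ¬ (s (+ (q + i)) ≡ T ⊎ s (+ (q + i)) ≡ R)
      inside i 1≤i (s≤s i≤d) = above (q + i) (ℕₚ.m<m+n q 1≤i)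
        (ℕₚ.≤-trans (ℕₚ.+-monoʳ-≤ q i≤d) (ℕₚ.≤-reflexive m≡))
      fixed : ∀ i → 1 ≤ i → i < suc (suc d) → s′ (+ i) ≡ s (+ (q + i))
      fixed i 1≤i i<d = merge-off R (λ p → inside i 1≤i i<d (inj₁ p))
      closed : s′ (+ 0) ≡ s′ (+ suc (suc d))
      closed = trans s′0 (sym (trans (cong (λ i → merge T R (s (+ i)))
        (trans (ℕₚ.+-suc q (suc d)) (cong suc m≡))) (merge-at T R)))
      gap : ∀ i → 1 ≤ i → i < suc (suc d) → s′ (+ i) ≢ s′ (+ 0)
      gap i 1≤i i<d p = inside i 1≤i i<d (inj₂ (trans (sym (fixed i 1≤i i<d)) (trans p s′0)))
      next : s (+ suc q) ≡ X
      next = trans (cong (λ i → s (+ i)) (ℕₚ.+-comm 1 q))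
        (trans (sym (fixed 1 ℕₚ.≤-refl (s≤s (s≤s z≤n))))
        (trans (Gap.gap-ends s′ (rainbowFree-map (merge T R) (rainbowFree-shift (+ q) rf)) (suc (suc d)) closed gap d refl)
        (trans (fixed (suc d) (s≤s z≤n) ℕₚ.≤-refl) (cong (λ i → s (+ i)) m≡))))
      absurd : s (+ q) ≡ T ⊎ s (+ q) ≡ R → Through hub (s (+ q)) (s (+ suc q)) → ⊥
      absurd (inj₁ p) (inj₁ e)        = ¬t (inj₁ (trans (sym next) (trans (sym e) p)))
      absurd (inj₂ p) (inj₁ e)        = r≢x (trans (sym p) (trans e next))
      absurd (inj₁ p) (inj₂ (inj₁ e)) = ¬t (inj₂ (inj₂ (trans (sym p) e)))
      absurd (inj₂ p) (inj₂ (inj₁ e)) = r≢h (trans (sym p) e)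
      absurd _        (inj₂ (inj₂ e)) = ¬t (inj₂ (inj₁ (trans (sym next) e)))

-- Congruences and dominant colours modulo a prime

-- A record rather than an abbreviation, so that n, x and y can be inferred from the type.
record Mod (n : ℕ) (x y : ℤ) : Set where
  constructor congruent
  field difference : + n ∣ᶻ x -ᶻ y
open Mod

Periodic : ℕ → (ℤ → ℕ) → Set
Periodic n c = ∀ {x y} → Mod n x y → c x ≡ c y

mod-refl : ∀ {n} x → Mod n x x
mod-refl x = congruent (divides (+ 0) (ℤₚ.+-inverseʳ x))

mod-reflexive : ∀ {n x y} → x ≡ y → Mod n x y
mod-reflexive {x = x} refl = mod-refl x

mod-sym : ∀ {n x y} → Mod n x y → Mod n y x
mod-sym {n} {x} {y} (congruent p) = congruent (subst (+ n ∣ᶻ_) (lemma x y) (∣m⇒∣-m p))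
  where
  lemma : ∀ x y → -ᶻ (x -ᶻ y) ≡ y -ᶻ x
  lemma = solve-∀

mod-trans : ∀ {n x y z} → Mod n x y → Mod n y z → Mod n x z
mod-trans {n} {x} {y} {z} (congruent p) (congruent q) = congruent (subst (+ n ∣ᶻ_) (lemma x y z) (∣m∣n⇒∣m+n p q))
  where
  lemma : ∀ x y z → (x -ᶻ y) +ᶻ (y -ᶻ z) ≡ x -ᶻ z
  lemma = solve-∀

mod-+ : ∀ {n x y a b} → Mod n x y → Mod n a b → Mod n (x +ᶻ a) (y +ᶻ b)
mod-+ {n} {x} {y} {a} {b} (congruent p) (congruent q) = congruent (subst (+ n ∣ᶻ_) (lemma x y a b) (∣m∣n⇒∣m+n p q))
  where
  lemma : ∀ x y a b → (x -ᶻ y) +ᶻ (a -ᶻ b) ≡ (x +ᶻ a) -ᶻ (y +ᶻ b)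
  lemma = solve-∀

mod-neg : ∀ {n x y} → Mod n x y → Mod n (-ᶻ x) (-ᶻ y)
mod-neg {n} {x} {y} (congruent p) = congruent (subst (+ n ∣ᶻ_) (lemma x y) (∣m⇒∣-m p))
  where
  lemma : ∀ x y → -ᶻ (x -ᶻ y) ≡ (-ᶻ x) -ᶻ (-ᶻ y)
  lemma = solve-∀

mod-* : ∀ {n x y} k → Mod n x y → Mod n (k *ᶻ x) (k *ᶻ y)
mod-* {n} {x} {y} k (congruent p) = congruent (subst (+ n ∣ᶻ_) (lemma k x y) (∣n⇒∣m*n k p))
  where
  lemma : ∀ k x y → k *ᶻ (x -ᶻ y) ≡ k *ᶻ x -ᶻ k *ᶻ y
  lemma = solve-∀

mod-∣ : ∀ {n x y} → Mod n x y → + n ∣ᶻ y → + n ∣ᶻ x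
mod-∣ {n} {x} {y} (congruent p) q = subst (+ n ∣ᶻ_) (lemma x y) (∣m∣n⇒∣m+n p q)
  where
  lemma : ∀ x y → (x -ᶻ y) +ᶻ y ≡ x
  lemma = solve-∀

mod-% : ∀ n .{{_ : NonZero n}} x → Mod n x (+ (x %ℕ n))
mod-% n x = congruent (divides (x /ℕ n) (trans (cong (_-ᶻ + (x %ℕ n)) (a≡a%ℕn+[a/ℕn]*n x n))
                                         (lemma (+ (x %ℕ n)) (x /ℕ n *ᶻ + n))))
  where
  lemma : ∀ r q → (r +ᶻ q) -ᶻ r ≡ q
  lemma = solve-∀

module _ {p : ℕ} (pp : Prime p) where
  abstract

    prime-inverse : ∀ d → ¬ + p ∣ᶻ d → ∃[ e ] Mod p (e *ᶻ d) (+ 1)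
    prime-inverse d p∤d = signed (ℤₚ.+∣i∣≡i⊎+∣i∣≡-i d) (natural (coprime-Bézout coprime))
      where
      coprime : Coprime p ∣ d ∣
      coprime (i∣p , i∣d) with prime⇒irreducible pp i∣p
      ... | inj₁ i≡1 = i≡1
      ... | inj₂ refl = contradiction (∣ᵤ⇒∣ i∣d) p∤d
      natural : Bézout.Identity.Identity 1 p ∣ d ∣ → ∃[ e ] Mod p (e *ᶻ + ∣ d ∣) (+ 1)
      natural (Bézout.Identity.+- x y eq) = -ᶻ + y , congruent (divides (-ᶻ + x) (trans (l₁ (+ y) (+ ∣ d ∣))
          (trans (cong -ᶻ_ (trans (cong (+ 1 +ᶻ_) (sym (ℤₚ.pos-* y ∣ d ∣))) (trans (cong +_ eq) (ℤₚ.pos-* x p))))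
                 (l₂ (+ x) (+ p)))))
        where
        l₁ : ∀ y d → -ᶻ y *ᶻ d -ᶻ + 1 ≡ -ᶻ (+ 1 +ᶻ y *ᶻ d)
        l₁ = solve-∀
        l₂ : ∀ x p → -ᶻ (x *ᶻ p) ≡ -ᶻ x *ᶻ p
        l₂ = solve-∀
      natural (Bézout.Identity.-+ x y eq) = + y , congruent (divides (+ x) (trans (cong (_-ᶻ + 1)
          (trans (sym (ℤₚ.pos-* y ∣ d ∣)) (trans (cong +_ (sym eq)) (cong (+ 1 +ᶻ_) (ℤₚ.pos-* x p)))))
          (l₁ (+ x *ᶻ + p))))
        where
        l₁ : ∀ x → (+ 1 +ᶻ x) -ᶻ + 1 ≡ x
        l₁ = solve-∀
      signed : + ∣ d ∣ ≡ d ⊎ + ∣ d ∣ ≡ -ᶻ d → ∃[ e ] Mod p (e *ᶻ + ∣ d ∣) (+ 1) → ∃[ e ] Mod p (e *ᶻ d) (+ 1)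
      signed (inj₁ q) (e , m) = e , subst (λ z → Mod p (e *ᶻ z) (+ 1)) q m
      signed (inj₂ q) (e , m) = -ᶻ e , subst (λ z → Mod p z (+ 1)) (trans (cong (e *ᶻ_) q) (l₁ e d)) m
        where
        l₁ : ∀ e d → e *ᶻ -ᶻ d ≡ -ᶻ e *ᶻ d
        l₁ = solve-∀

    -- A step prime to p generates all residues; k is (y - x)/d reduced modulo p.
    walk : ∀ d → ¬ + p ∣ᶻ d → ∀ x y → ∃[ k ] (k < p × Mod p (affine x d (+ k)) y)
    walk d p∤d x y with prime-inverse d p∤d
    ... | e , inv = k , n%ℕd<d (e *ᶻ (y -ᶻ x)) p , subst (λ w → Mod p w y) (sym (affine-def x d (+ k))) (congruent (subst (+ p ∣ᶻ_) (lemma x y e d (+ k))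
            (∣m∣n⇒∣m-n (∣n⇒∣m*n (y -ᶻ x) (difference inv)) (∣n⇒∣m*n d (difference (mod-% p (e *ᶻ (y -ᶻ x))))))))
      where
      instance
        nonZero : NonZero p
        nonZero = prime⇒nonZero pp
      k : ℕ
      k = (e *ᶻ (y -ᶻ x)) %ℕ p
      lemma : ∀ x y e d k → (y -ᶻ x) *ᶻ (e *ᶻ d -ᶻ + 1) -ᶻ d *ᶻ (e *ᶻ (y -ᶻ x) -ᶻ k) ≡ (x +ᶻ k *ᶻ d) -ᶻ y
      lemma = solve-∀

-- The number of colours of c is measured by the lengths of such lists.
Distinct : (ℤ → ℕ) → List ℤ → Set
Distinct c = AllPairs (λ x y → c x ≢ c y)

module _ (c : ℤ → ℕ) where

  off? : ∀ h → Decidable (λ x → c x ≢ h)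
  off? h x = ¬? (c x ≟ h)

  off-all : ∀ h {xs} → All (λ x → c x ≢ h) xs → length xs ≤ length (filter (off? h) xs)
  off-all h [] = z≤n
  off-all h {x ∷ xs} (x≢h ∷ a) rewrite filter-accept (off? h) {xs = xs} x≢h = s≤s (off-all h a)

  length-off : ∀ h {xs} → Distinct c xs → length xs ≤ suc (length (filter (off? h) xs))
  length-off h [] = z≤n
  length-off h {x ∷ xs} (x# ∷ d) = by (c x ≟ h)
    where
    by : Dec (c x ≡ h) → suc (length xs) ≤ suc (length (filter (off? h) (x ∷ xs)))
    by (no x≢h) rewrite filter-accept (off? h) {xs = xs} x≢h = s≤s (length-off h d)
    by (yes refl) rewrite filter-reject (off? h) {xs = xs} (λ ne → ne refl) =
      s≤s (off-all h (All.map (λ ne e → ne (sym e)) x#))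

  abstract
    -- Each forbidden colour removes at most one element of a list with distinct colours.
    avoid : ∀ hs {xs} → Distinct c xs → length hs < length xs → ∃[ x ] (x ∈ xs × All (c x ≢_) hs)
    avoid [] {x ∷ xs} _ _ = x , here refl , []
    avoid (h ∷ hs) {xs} d lt with avoid hs (AllPairsₚ.filter⁺ (off? h) d) (ℕₚ.≤-pred (ℕₚ.≤-trans lt (length-off h d)))
    ... | x , x∈ , ne with ∈-filter⁻ (off? h) {xs = xs} x∈
    ... | x∈xs , x≢h = x , x∈xs , x≢h ∷ ne

Dominant : (ℤ → ℕ) → ℤ → ℕ → Set
Dominant c d h = ∀ x → Through h (c x) (c (x +ᶻ d))

module _ {p : ℕ} (pp : Prime p) {c : ℤ → ℕ} (per : Periodic p c) where

  leave : ∀ d → ¬ + p ∣ᶻ d → ∀ x y → c y ≢ c x →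
    ∃[ l ] (c (affine x d (+ l)) ≡ c x × c (affine x d (+ suc l)) ≢ c x)
  leave d p∤d x y cy≢cx = go (walk pp d p∤d x y)
    where
    f : ℕ → ℕ
    f l = c (affine x d (+ l))
    f0 : f 0 ≡ c x
    f0 = cong c (affine-zero x d)
    go : ∃[ k ] (k < p × Mod p (affine x d (+ k)) y) → ∃[ l ] (f l ≡ c x × f (suc l) ≢ c x)
    go (n , _ , reach) with leaves f n (λ e → cy≢cx (trans (sym (per reach)) (trans e f0)))
    ... | l , stay , ne = l , trans stay f0 , λ e → ne (trans e (sym f0))

  -- The walk a, a + d, a + 2d, ... starts where the colour changes, and its first term of a third
  -- colour provides the data for `Hub`. The walk passes through every class, so the statement on
  -- consecutive terms holds for all x and x + d.
  dominant-exists : RainbowFree c → ∀ {xs} → Distinct c xs → 3 ≤ length xs →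
    ∀ d → ¬ + p ∣ᶻ d → ∃[ h ] Dominant c d h
  dominant-exists rf dis 3≤ d p∤d with avoid c [] dis (ℕₚ.≤-trans (s≤s z≤n) 3≤)
  ... | x , _ , _ with avoid c (c x ∷ []) dis (ℕₚ.≤-trans (s≤s (s≤s z≤n)) 3≤)
  ... | y , _ , y≢x ∷ [] with leave d p∤d x y y≢x
  ... | l , stay , go = found
    where
    a : ℤ
    a = affine x d (+ l)
    s : ℤ → ℕ
    s i = c (affine a d i)
    s-zero : s (+ 0) ≡ c a
    s-zero = cong c (affine-zero a d)
    s-one : s (+ 1) ≡ c (affine x d (+ suc l))
    s-one = cong c (trans (sym (affine-suc a d 0)) (trans (cong (_+ᶻ d) (affine-zero a d)) (affine-suc x d l)))
    s0≢s1 : s (+ 0) ≢ s (+ 1)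
    s0≢s1 e = go (trans (sym s-one) (trans (sym e) (trans s-zero stay)))
    new : ℕ → Set
    new i = s (+ i) ≢ s (+ 0) × s (+ i) ≢ s (+ 1)
    new? : Decidable new
    new? i = ¬? (s (+ i) ≟ s (+ 0)) ×-dec ¬? (s (+ i) ≟ s (+ 1))
    known : ∀ i → ¬ new i → s (+ i) ≡ s (+ 0) ⊎ s (+ i) ≡ s (+ 1)
    known i old with s (+ i) ≟ s (+ 0) | s (+ i) ≟ s (+ 1)
    ... | yes e | _     = inj₁ e
    ... | no _  | yes e = inj₂ e
    ... | no ne | no nf = contradiction (ne , nf) old
    found : ∃[ h ] Dominant c d h
    found with avoid c (s (+ 0) ∷ s (+ 1) ∷ []) dis 3≤
    ... | w , _ , w≢0 ∷ w≢1 ∷ [] with walk pp d p∤d a w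
    ... | n , _ , reach with least {P = new} new? n
        ((λ e → w≢0 (trans (sym (per reach)) e)) , λ e → w≢1 (trans (sym (per reach)) e))
    ... | zero , _ , (ne , _) , _ = contradiction refl ne
    ... | suc j , _ , (ne , nf) , below = hub , dominates
      where
      open Hub s (rainbowFree-affine a d rf) s0≢s1 j ne nf (λ i i<j → known i (below i i<j))
      dominates : Dominant c d hub
      dominates u with walk pp d p∤d a u
      ... | m , _ , r = subst₂ (Through hub) (per r)
              (trans (cong c (sym (affine-suc a d m))) (per (mod-+ r (mod-refl d)))) (through-hub m)

  enter : ∀ {d h} → ¬ + p ∣ᶻ d → Dominant c d h → ∀ x y → c y ≢ c x → c x ≢ h →
    ∃[ u ] (c u ≡ c x × c (u +ᶻ d) ≡ h)
  enter {d} {h} p∤d dom x y y≢x x≢h with leave d p∤d x y y≢x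
  ... | l , stay , go with dom (affine x d (+ l))
  ... | inj₁ e = contradiction (trans (cong c (sym (affine-suc x d l))) (trans (sym e) stay)) go
  ... | inj₂ (inj₁ e) = contradiction (trans (sym stay) e) x≢h
  ... | inj₂ (inj₂ e) = affine x d (+ l) , stay , e

  -- Where a walk with step d leaves a colour r other than h and k, the next colour must be both h
  -- and k.
  dominant-unique : ∀ {xs} → Distinct c xs → 3 ≤ length xs → ∀ {d h k} → ¬ + p ∣ᶻ d → Dominant c d h → Dominant c d k → h ≡ k
  dominant-unique dis 3≤ {d} {h} {k} p∤d domₕ domₖ with avoid c (h ∷ k ∷ []) dis 3≤
  ... | r , _ , r≢h ∷ r≢k ∷ [] with avoid c (c r ∷ []) dis (ℕₚ.≤-trans (s≤s (s≤s z≤n)) 3≤)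
  ... | t , _ , t≢r ∷ [] with enter p∤d domₕ r t t≢r r≢h
  ... | u , u≡r , ud≡h with domₖ u
  ... | inj₁ e = contradiction (trans (sym u≡r) (trans e ud≡h)) r≢h
  ... | inj₂ (inj₁ e) = contradiction (trans (sym u≡r) e) r≢k
  ... | inj₂ (inj₂ e) = trans (sym ud≡h) e

  dominant-mod : ∀ {d e h} → Mod p d e → Dominant c d h → Dominant c e h
  dominant-mod {d} {e} {h} m dom x = subst (Through h (c x)) (per (mod-+ (mod-refl x) m)) (dom x)

  dominant-neg : ∀ {d h} → Dominant c d h → Dominant c (-ᶻ d) h
  dominant-neg {d} {h} dom x = flip (subst (λ w → Through h (c (x -ᶻ d)) (c w)) (lemma x d) (dom (x -ᶻ d)))
    where
    lemma : ∀ x d → (x -ᶻ d) +ᶻ d ≡ x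
    lemma = solve-∀
    flip : ∀ {a b} → Through h a b → Through h b a
    flip (inj₁ e)        = inj₁ (sym e)
    flip (inj₂ (inj₁ e)) = inj₂ (inj₂ e)
    flip (inj₂ (inj₂ e)) = inj₂ (inj₁ e)

  -- If c x and c (x + 2d) differ from each other and from h, then x + d has colour h and the
  -- progression is rainbow.
  dominant-double : RainbowFree c → ∀ {d h} → Dominant c d h → Dominant c (d +ᶻ d) h
  dominant-double rf {d} {h} dom x with through? h (c x) (c (x +ᶻ (d +ᶻ d)))
  ... | yes t = t
  ... | no ¬t = ⊥-elim (impossible (rf x (x +ᶻ d) (x +ᶻ (d +ᶻ d)) (lemma x d)))
    where
    lemma : ∀ x d → x +ᶻ (x +ᶻ (d +ᶻ d)) ≡ (x +ᶻ d) +ᶻ (x +ᶻ d)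
    lemma = solve-∀
    second : Through h (c (x +ᶻ d)) (c (x +ᶻ (d +ᶻ d)))
    second = subst (λ w → Through h (c (x +ᶻ d)) (c w)) (ℤₚ.+-assoc x d d) (dom (x +ᶻ d))
    impossible : Coincide (c x) (c (x +ᶻ d)) (c (x +ᶻ (d +ᶻ d))) → ⊥
    impossible (inj₂ (inj₁ e)) = ¬t (inj₁ e)
    impossible (inj₁ e) = ¬t (subst (λ w → Through h w (c (x +ᶻ (d +ᶻ d)))) (sym e) second)
    impossible (inj₂ (inj₂ e)) = ¬t (subst (Through h (c x)) e (dom x))

-- At most three colours modulo a prime

module Ultrametric {p : ℕ} (pp : Prime p) (D : ℤ → ℕ) (per : Periodic p D)
  (zero-at : ∀ {x} → + p ∣ᶻ x → D x ≡ 0)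
  (neg : ∀ x → D (-ᶻ x) ≡ D x)
  (sum : ∀ x y → D x ≢ 0 → D y ≢ 0 → D x ≢ D y → D (x +ᶻ y) ≡ D x ⊎ D (x +ᶻ y) ≡ D y) where

  record Run (k : ℕ) : Set where
    constructor run
    field
      colour : ℕ
      start step : ℤ
      colour≢0 : colour ≢ 0
      step≢0 : D step ≢ 0
      step≢ : D step ≢ colour
      mono : ∀ j → j < k → D (affine start step (+ j)) ≡ colour

  -- A run that cannot be prolonged backwards: by `sum`, the value of D at x - y is X or D y, and
  -- here it is D y.
  record Sharp (k X : ℕ) (x y : ℤ) : Set where
    constructor sharp
    field
      mono : ∀ j → j < k → D (affine x y (+ j)) ≡ X
      before : D (x -ᶻ y) ≡ D y

  module _ {y : ℤ} (y≢0 : D y ≢ 0) where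

    next : ∀ {x X} → D x ≡ X → X ≢ 0 → D y ≢ X → D (x +ᶻ y) ≡ X ⊎ D (x +ᶻ y) ≡ D y
    next {x} refl x≢0 y≢x = sum x y x≢0 y≢0 (y≢x ∘ sym)

    sharpen : ∀ {k X x} → X ≢ 0 → D y ≢ X → (∀ j → j < suc k → D (affine x y (+ j)) ≡ X) →
      Run (suc (suc k)) ⊎ Sharp (suc k) X x y
    sharpen {k} {X} {x} X≢0 y≢X mono = by (sum x (-ᶻ y) (λ e → X≢0 (trans (sym x≡X) e)) (λ e → y≢0 (trans (sym (neg y)) e))
        (λ e → y≢X (trans (sym (neg y)) (trans (sym e) x≡X))))
      where
      x≡X : D x ≡ X
      x≡X = trans (cong D (sym (affine-zero x y))) (mono 0 (s≤s z≤n))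
      lemma : ∀ x y → (x -ᶻ y) +ᶻ y ≡ x
      lemma = solve-∀
      by : D (x -ᶻ y) ≡ D x ⊎ D (x -ᶻ y) ≡ D (-ᶻ y) → Run (suc (suc k)) ⊎ Sharp (suc k) X x y
      by (inj₂ e) = inj₂ (sharp mono (trans e (neg y)))
      by (inj₁ e) = inj₁ (run X (x -ᶻ y) y X≢0 y≢0 y≢X longer)
        where
        longer : ∀ j → j < suc (suc k) → D (affine (x -ᶻ y) y (+ j)) ≡ X
        longer zero _ = trans (cong D (affine-zero (x -ᶻ y) y)) (trans e x≡X)
        longer (suc j) (s≤s j<k) = trans (cong D (trans (sym (affine-suc (x -ᶻ y) y j))
          (trans (sym (affine-shift (x -ᶻ y) y y (+ j))) (cong (λ w → affine w y (+ j)) (lemma x y))))) (mono j j<k)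

    shift : ∀ {k X x z} → X ≢ 0 → D y ≢ X → D z ≢ 0 → D z ≢ X → D z ≢ D y → Sharp (suc k) X x y →
      Run (suc (suc k)) ⊎ Sharp (suc k) (D (x +ᶻ z)) (x +ᶻ z) y × (D (x +ᶻ z) ≡ X ⊎ D (x +ᶻ z) ≡ D z)
    shift {k} {X} {x} {z} X≢0 y≢X z≢0 z≢X z≢y (sharp mono _) = by (sharpen W≢0 y≢W all)
      where
      W : ℕ
      W = D (x +ᶻ z)
      sides : ∀ j → j < suc k → D (affine (x +ᶻ z) y (+ j)) ≡ X ⊎ D (affine (x +ᶻ z) y (+ j)) ≡ D z
      sides j j<k = subst (λ w → D w ≡ X ⊎ D w ≡ D z) (sym (affine-shift x y z (+ j)))
        (from (sum (affine x y (+ j)) z (λ e → X≢0 (trans (sym (mono j j<k)) e)) z≢0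
          (λ e → z≢X (trans (sym e) (mono j j<k)))))
        where
        from : ∀ {w} → w ≡ D (affine x y (+ j)) ⊎ w ≡ D z → w ≡ X ⊎ w ≡ D z
        from (inj₁ e) = inj₁ (trans e (mono j j<k))
        from (inj₂ e) = inj₂ e
      W-sides : W ≡ X ⊎ W ≡ D z
      W-sides = subst (λ w → D w ≡ X ⊎ D w ≡ D z) (affine-zero (x +ᶻ z) y) (sides 0 (s≤s z≤n))
      W≢0 : W ≢ 0
      W≢0 e with W-sides
      ... | inj₁ q = X≢0 (trans (sym q) e)
      ... | inj₂ q = z≢0 (trans (sym q) e)
      y≢W : D y ≢ W
      y≢W e with W-sides
      ... | inj₁ q = y≢X (trans e q)
      ... | inj₂ q = z≢y (trans (sym q) (sym e))
      all : ∀ j → j < suc k → D (affine (x +ᶻ z) y (+ j)) ≡ W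
      all zero _ = cong D (affine-zero (x +ᶻ z) y)
      all (suc j) j<k with next (all j (ℕₚ.<-trans (ℕₚ.n<1+n j) j<k)) W≢0 y≢W
      ... | inj₁ e = trans (cong D (sym (affine-suc (x +ᶻ z) y j))) e
      ... | inj₂ e = ⊥-elim (clash (sides (suc j) j<k) (trans (cong D (sym (affine-suc (x +ᶻ z) y j))) e))
        where
        clash : ∀ {w} → w ≡ X ⊎ w ≡ D z → w ≡ D y → ⊥
        clash (inj₁ q) r = y≢X (trans (sym r) q)
        clash (inj₂ q) r = z≢y (trans (sym q) r)
      by : Run (suc (suc k)) ⊎ Sharp (suc k) W (x +ᶻ z) y →
        Run (suc (suc k)) ⊎ Sharp (suc k) W (x +ᶻ z) y × (W ≡ X ⊎ W ≡ D z)
      by (inj₁ r) = inj₁ r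
      by (inj₂ r) = inj₂ (r , W-sides)

    -- Translating by z again and again, the value of the run must change somewhere before its start
    -- reaches a point of another value; x′ starts the last run of value X before the change.
    change : ∀ {k X z} → X ≢ 0 → D y ≢ X → D z ≢ 0 → D z ≢ X → D z ≢ D y →
      ∀ n {x} → Sharp (suc k) X x y → D (affine x z (+ n)) ≢ X →
      Run (suc (suc k)) ⊎ ∃[ x′ ] (Sharp (suc k) X x′ y × Sharp (suc k) (D z) (x′ +ᶻ z) y)
    change {z = z} X≢0 y≢X z≢0 z≢X z≢y zero {x} s ne =
      contradiction (trans (cong D (trans (affine-zero x z) (sym (affine-zero x y)))) (Sharp.mono s 0 (s≤s z≤n))) ne
    change {k} {X} {z} X≢0 y≢X z≢0 z≢X z≢y (suc n) {x} s ne with shift X≢0 y≢X z≢0 z≢X z≢y s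
    ... | inj₁ r = inj₁ r
    ... | inj₂ (t , inj₂ e) = inj₂ (x , s , subst (λ w → Sharp (suc k) w (x +ᶻ z) y) e t)
    ... | inj₂ (t , inj₁ e) = change X≢0 y≢X z≢0 z≢X z≢y n (subst (λ w → Sharp (suc k) w (x +ᶻ z) y) e t)
            (λ q → ne (trans (cong D (trans (sym (affine-suc x z n)) (sym (affine-shift x z z (+ n))))) q))

  module _ {a b c : ℤ} (dis : Distinct D (a ∷ b ∷ c ∷ []))
           (a≢0 : D a ≢ 0) (b≢0 : D b ≢ 0) (c≢0 : D c ≢ 0) where

    third : ∀ X Y → ∃[ z ] (D z ≢ 0 × D z ≢ X × D z ≢ Y)
    third X Y with avoid D (X ∷ Y ∷ []) dis ℕₚ.≤-refl
    ... | z , z∈ , z≢X ∷ z≢Y ∷ [] = z , (λ e → All.lookup (a≢0 ∷ b≢0 ∷ c≢0 ∷ []) z∈ e) , z≢X , z≢Y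

    -- Two translates of the run J of colour D z would both contain z, one starting and the other ending there.
    extend : ∀ {k} → Run (suc (suc k)) → Run (suc (suc (suc k)))
    extend {k} (run X x y X≢0 y≢0 y≢X mono) with sharpen y≢0 X≢0 y≢X mono
    ... | inj₁ r = r
    ... | inj₂ s with third X (D y)
    ... | z , z≢0 , z≢X , z≢y with walk pp z (λ p∣z → z≢0 (zero-at p∣z)) x (-ᶻ z)
    ... | n , _ , reach with change y≢0 X≢0 y≢X z≢0 z≢X z≢y n s
                              (λ e → z≢X (trans (sym (neg z)) (trans (sym (per reach)) e)))
    ... | inj₁ r = r
    ... | inj₂ (x′ , I , J) = by (back 0 (s≤s z≤n)) (back (suc k) ℕₚ.≤-refl)
      where
      i : ℕ → ℤ
      i j = affine x′ y (+ j)
      -i≡ : ∀ j → j < suc (suc k) → D (-ᶻ i j) ≡ X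
      -i≡ j j<k = trans (neg (i j)) (Sharp.mono I j j<k)
      Back : ℕ → Set
      Back j = Run (suc (suc (suc k))) ⊎
        Sharp (suc (suc k)) (D ((x′ +ᶻ z) -ᶻ i j)) ((x′ +ᶻ z) -ᶻ i j) y
      -- Translation by -i j is an instance of `shift`, because D (-i j) = X differs from D z and D
      -- y.
      back : ∀ j → j < suc (suc k) → Back j
      back j j<k with shift y≢0 {x = x′ +ᶻ z} {z = -ᶻ i j} z≢0 (λ e → z≢y (sym e)) (λ e → X≢0 (trans (sym (-i≡ j j<k)) e))
                         (λ e → z≢X (trans (sym e) (-i≡ j j<k))) (λ e → y≢X (trans (sym e) (-i≡ j j<k))) J
      ... | inj₁ r = inj₁ r
      ... | inj₂ (t , _) = inj₂ t
      lemma : ∀ x z → (x +ᶻ z) -ᶻ x ≡ z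
      lemma = solve-∀
      lemma′ : ∀ x z i y → ((x +ᶻ z) -ᶻ (i +ᶻ y)) ≡ (x -ᶻ (i +ᶻ y)) +ᶻ z
      lemma′ = solve-∀
      lemma″ : ∀ i z y → (i -ᶻ (i +ᶻ y)) +ᶻ z ≡ z -ᶻ y
      lemma″ = solve-∀
      lemma‴ : ∀ x i z → (x -ᶻ i) +ᶻ z ≡ (x +ᶻ z) -ᶻ i
      lemma‴ = solve-∀
      start₀ : (x′ +ᶻ z) -ᶻ i 0 ≡ z
      start₀ = trans (cong (λ w → (x′ +ᶻ z) -ᶻ w) (affine-zero x′ y)) (lemma x′ z)
      place : ∀ j → affine ((x′ +ᶻ z) -ᶻ i (suc k)) y (+ j) ≡ (i j +ᶻ z) -ᶻ i (suc k)
      place j = trans (affine-shift (x′ +ᶻ z) y (-ᶻ i (suc k)) (+ j)) (cong (λ w → w -ᶻ i (suc k)) (affine-shift x′ y z (+ j)))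
      place-last : affine ((x′ +ᶻ z) -ᶻ i (suc k)) y (+ suc k) ≡ z
      place-last = trans (place (suc k)) (lemma (i (suc k)) z)
      place-previous : affine ((x′ +ᶻ z) -ᶻ i (suc k)) y (+ k) ≡ z -ᶻ y
      place-previous = trans (place k) (trans (sym (lemma‴ (i k) (i (suc k)) z))
        (trans (cong (λ w → (i k -ᶻ w) +ᶻ z) (sym (affine-suc x′ y k))) (lemma″ (i k) z y)))
      by : Back 0 → Back (suc k) → Run (suc (suc (suc k)))
      by (inj₁ r) _ = r
      by (inj₂ _) (inj₁ r) = r
      -- Sharpness of the translate starting at z gives D (z - y) = D y; the other one contains both
      -- z - y and z, so D (z - y) = D z.
      by (inj₂ s₀) (inj₂ s₁) = contradiction (trans at-z (trans (sym at-z-y) before)) z≢y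
        where
        at-z = trans (cong D (sym place-last)) (Sharp.mono s₁ (suc k) ℕₚ.≤-refl)
        at-z-y = trans (cong D (sym place-previous)) (Sharp.mono s₁ k (ℕₚ.n≤1+n _))
        before = trans (cong (λ w → D (w -ᶻ y)) (sym start₀)) (Sharp.before s₀)

    a≢c : D a ≢ D c
    a≢c = All.head (All.tail (AllPairs.head dis))

    -- Walking from a with step c, let a′ be a point after which the value D a is left. Then D (a′ +
    -- c) = D c, so c and c + a′ form a run with step a′.
    initial : Run 2
    initial with walk pp c (λ p∣c → c≢0 (zero-at p∣c)) a (-ᶻ c)
    ... | n , _ , reach with leaves (λ l → D (affine a c (+ l))) n
          (λ e → a≢c (trans (cong D (sym (affine-zero a c))) (trans (sym e) (trans (per reach) (neg c)))))
    ... | l , stay , go = run (D c) c a′ c≢0 a′≢0 a′≢c mono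
      where
      a′ : ℤ
      a′ = affine a c (+ l)
      a′≡a : D a′ ≡ D a
      a′≡a = trans stay (cong D (affine-zero a c))
      a′≢0 : D a′ ≢ 0
      a′≢0 e = a≢0 (trans (sym a′≡a) e)
      a′≢c : D a′ ≢ D c
      a′≢c e = a≢c (trans (sym a′≡a) e)
      mono : ∀ j → j < 2 → D (affine c a′ (+ j)) ≡ D c
      mono zero _ = cong D (affine-zero c a′)
      mono (suc zero) _ with sum a′ c a′≢0 c≢0 a′≢c
      ... | inj₁ e = contradiction (trans (cong D (sym (affine-suc a c l))) (trans e stay)) go
      ... | inj₂ e = trans (cong D (trans (sym (affine-suc c a′ 0)) (trans (cong (_+ᶻ a′) (affine-zero c a′)) (ℤₚ.+-comm c a′)))) e
      mono (suc (suc _)) (s≤s (s≤s ()))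

    runs : ∀ k → Run (suc (suc k))
    runs zero = initial
    runs (suc k) = extend (runs k)

    -- A run of length p + 2 meets a multiple of p, where D is 0.
    absurd : ⊥
    absurd with runs p
    ... | run X x y X≢0 y≢0 y≢X mono with walk pp y (λ p∣y → y≢0 (zero-at p∣y)) x (+ 0)
    ... | n , n<p , reach = X≢0 (trans (sym (mono n (ℕₚ.m≤n⇒m≤1+n (ℕₚ.m≤n⇒m≤1+n n<p)))) (trans (per reach) (zero-at (divides (+ 0) refl))))

small-multiple : ∀ {n k} → k < n → n ℕ∣.∣ k → k ≡ 0
small-multiple {k = zero} _ _ = refl
small-multiple {k = suc k} k<n n∣k = contradiction (ℕ∣.∣⇒≤ n∣k) (ℕₚ.<⇒≱ k<n)

mod-bounded : ∀ {n a b} → a < n → b < n → Mod n (+ a) (+ b) → a ≡ b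
mod-bounded {n} {a} {b} a<n b<n m = by (ℕₚ.≤-total a b)
  where
  ordered : ∀ {a b} → a ≤ b → b < n → Mod n (+ b) (+ a) → a ≡ b
  ordered {a} {b} a≤b b<n (congruent d) = sym (ℕₚ.≤-antisym (ℕₚ.m∸n≡0⇒m≤n
    (small-multiple (ℕₚ.≤-<-trans (ℕₚ.m∸n≤m b a) b<n)
      (subst (n ℕ∣.∣_) (cong ∣_∣ (trans (ℤₚ.[+m]-[+n]≡m⊖n b a) (ℤₚ.⊖-≥ a≤b))) (∣⇒∣ᵤ d)))) a≤b)
  by : a ≤ b ⊎ b ≤ a → a ≡ b
  by (inj₁ a≤b) = ordered a≤b b<n (mod-sym m)
  by (inj₂ b≤a) = sym (ordered b≤a a<n m)

module _ {n : ℕ} .{{_ : NonZero n}} where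
  abstract
    residue : ℤ → Fin n
    residue x = fromℕ< (n%ℕd<d x n)

    residue-sound : ∀ x → Mod n x (+ toℕ (residue x))
    residue-sound x = subst (λ k → Mod n x (+ k)) (sym (toℕ-fromℕ< (n%ℕd<d x n))) (mod-% n x)

  residue-cong : ∀ {x y} → Mod n x y → residue x ≡ residue y
  residue-cong {x} {y} m = toℕ-injective (mod-bounded (toℕ<n _) (toℕ<n _)
    (mod-trans (mod-sym (residue-sound x)) (mod-trans m (residue-sound y))))

  residue-toℕ : ∀ i → residue (+ toℕ i) ≡ i
  residue-toℕ i = toℕ-injective (mod-bounded (toℕ<n _) (toℕ<n _) (mod-sym (residue-sound (+ toℕ i))))

  -- A predicate that respects congruence needs checking on one representative of each class only.
  exists-mod? : ∀ {P : ℤ → Set} → Decidable P → (∀ {x y} → Mod n x y → P x → P y) → Dec (∃[ x ] P x)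
  exists-mod? P? resp with any? (λ i → P? (+ toℕ {n} i))
  ... | yes (i , pi) = yes (+ toℕ i , pi)
  ... | no none = no λ { (x , px) → none (residue x , resp (residue-sound x) px) }

2∣twice : ∀ w → 2 ℕ∣.∣ w + w
2∣twice w = ℕ∣.divides w (trans (cong (λ v → w + v) (sym (ℕₚ.+-identityʳ w))) (ℕₚ.*-comm 2 w))

odd-half : ∀ {n} → ¬ 2 ℕ∣.∣ n → ∀ {x} → + n ∣ᶻ x +ᶻ x → + n ∣ᶻ x
odd-half {n} odd {x} d with parity n
... | twice w = contradiction (2∣twice w) odd
... | twice+1 w = subst (+ suc (w + w) ∣ᶻ_) (lemma (+ w) x) (∣m∣n⇒∣m-n (∣m⇒∣m*n x ∣-refl) (∣n⇒∣m*n (+ w) d))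
  where
  lemma : ∀ w x → (+ 1 +ᶻ (w +ᶻ w)) *ᶻ x -ᶻ w *ᶻ (x +ᶻ x) ≡ x
  lemma = solve-∀

mod-difference : ∀ {n c} → Periodic n c → ∀ {x y} → c x ≢ c y → ¬ + n ∣ᶻ x -ᶻ y
mod-difference per x≢y d = x≢y (per (congruent d))

module Hubs {p : ℕ} (pp : Prime p) {c : ℤ → ℕ} (per : Periodic p c) (rf : RainbowFree c)
            {xs : List ℤ} (dis : Distinct c xs) (3≤ : 3 ≤ length xs) where

  abstract
    -- Dominant colours are shifted by one, so that 0 marks the multiples of p.
    D : ℤ → ℕ
    D d with + p ∣ᶻ? d
    ... | yes _  = 0
    ... | no p∤d = suc (proj₁ (dominant-exists pp per rf dis 3≤ d p∤d))

    D-multiple : ∀ {d} → + p ∣ᶻ d → D d ≡ 0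
    D-multiple {d} p∣d with + p ∣ᶻ? d
    ... | yes _  = refl
    ... | no p∤d = contradiction p∣d p∤d

    D-dominant : ∀ d → ¬ + p ∣ᶻ d → ∃[ h ] (D d ≡ suc h × Dominant c d h)
    D-dominant d p∤d with + p ∣ᶻ? d
    ... | yes p∣d = contradiction p∣d p∤d
    ... | no p∤d′ = _ , refl , proj₂ (dominant-exists pp per rf dis 3≤ d p∤d′)

  D-unique : ∀ {d h} → ¬ + p ∣ᶻ d → Dominant c d h → D d ≡ suc h
  D-unique {d} p∤d dom with D-dominant d p∤d
  ... | k , e , dom′ = trans e (cong suc (dominant-unique pp per dis 3≤ p∤d dom′ dom))

  D≢0 : ∀ {d} → D d ≢ 0 → ¬ + p ∣ᶻ d
  D≢0 ne p∣d = ne (D-multiple p∣d)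

  D-periodic : Periodic p D
  D-periodic {x} {y} m = by (+ p ∣ᶻ? x)
    where
    by : Dec (+ p ∣ᶻ x) → D x ≡ D y
    by (yes d) = trans (D-multiple d) (sym (D-multiple (mod-∣ (mod-sym m) d)))
    by (no nd) with D-dominant x nd
    ... | h , e , dom = trans e (sym (D-unique (λ d → nd (mod-∣ m d)) (dominant-mod pp per m dom)))

  D-neg : ∀ x → D (-ᶻ x) ≡ D x
  D-neg x = by (+ p ∣ᶻ? x)
    where
    by : Dec (+ p ∣ᶻ x) → D (-ᶻ x) ≡ D x
    by (yes d) = trans (D-multiple (∣m⇒∣-m d)) (sym (D-multiple d))
    by (no nd) with D-dominant x nd
    ... | h , e , dom = trans (D-unique (λ d → nd (subst (+ p ∣ᶻ_) (ℤₚ.neg-involutive x) (∣m⇒∣-m d))) (dominant-neg pp per dom)) (sym e)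

  D-double : ¬ 2 ℕ∣.∣ p → ∀ x → D (x +ᶻ x) ≡ D x
  D-double odd x = by (+ p ∣ᶻ? x)
    where
    by : Dec (+ p ∣ᶻ x) → D (x +ᶻ x) ≡ D x
    by (yes d) = trans (D-multiple (∣m∣n⇒∣m+n d d)) (sym (D-multiple d))
    by (no nd) with D-dominant x nd
    ... | h , e , dom = trans (D-unique (λ d → nd (odd-half odd d)) (dominant-double pp per rf dom)) (sym e)

  abstract
    -- Take x and y of two different colours outside hs: the dominant colour of y - x is one of
    -- these two.
    fresh : ∀ hs → suc (length hs) < length xs → ∃[ d ] (D d ≢ 0 × All (λ h → D d ≢ suc h) hs)
    fresh hs lt with avoid c hs dis (ℕₚ.<-trans (ℕₚ.n<1+n _) lt)
    ... | x , _ , x∉ with avoid c (c x ∷ hs) dis lt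
    ... | y , _ , y≢x ∷ y∉ with D-dominant (y -ᶻ x) (mod-difference per y≢x)
    ... | h , e , dom = y -ᶻ x , (λ z → ℕₚ.1+n≢0 (trans (sym e) z)) , by (dom x)
      where
      lemma : ∀ x y → x +ᶻ (y -ᶻ x) ≡ y
      lemma = solve-∀
      off : ∀ {z} → z ≡ h → All (z ≢_) hs → All (λ h → D (y -ᶻ x) ≢ suc h) hs
      off z≡h = All.map (λ ne q → ne (trans z≡h (ℕₚ.suc-injective (trans (sym e) q))))
      by : Through h (c x) (c (x +ᶻ (y -ᶻ x))) → All (λ h → D (y -ᶻ x) ≢ suc h) hs
      by (inj₁ q) = contradiction (trans (cong c (sym (lemma x y))) (sym q)) y≢x
      by (inj₂ (inj₁ q)) = off q x∉
      by (inj₂ (inj₂ q)) = off (trans (cong c (sym (lemma x y))) q) y∉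

  -- With four colours there is a colour w other than the dominant colours h, k, l of x, y, x + y.
  -- Some u of colour w has u + x + y of colour l; following u, u + x, u + x + y, the change from w
  -- to l can only happen if l is h or k.
  D-sum : 4 ≤ length xs → ∀ x y → D x ≢ 0 → D y ≢ 0 → D x ≢ D y → D (x +ᶻ y) ≡ D x ⊎ D (x +ᶻ y) ≡ D y
  D-sum 4≤ x y x≢0 y≢0 x≢y
    with D-dominant x (D≢0 x≢0) | D-dominant y (D≢0 y≢0) | D-dominant (x +ᶻ y) p∤x+y
    where
    -- Otherwise x would be congruent to -y, and D x = D y.
    p∤x+y : ¬ + p ∣ᶻ x +ᶻ y
    p∤x+y d = x≢y (trans (D-periodic (congruent (subst (λ w → + p ∣ᶻ x +ᶻ w) (sym (ℤₚ.neg-involutive y)) d))) (D-neg y))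
  ... | h , eh , domₓ | k , ek , domᵧ | l , el , dom with avoid c (h ∷ k ∷ l ∷ []) dis 4≤
  ... | w , _ , w≢h ∷ w≢k ∷ w≢l ∷ [] with avoid c (c w ∷ []) dis (ℕₚ.≤-trans (s≤s (s≤s z≤n)) 3≤)
  ... | v , _ , v≢w ∷ [] with enter pp per (λ d → ℕₚ.1+n≢0 (trans (sym el) (D-multiple d))) dom w v v≢w w≢l
  ... | u , u≡w , ue≡l = by (domₓ u) (domᵧ (u +ᶻ x))
    where
    end : c ((u +ᶻ x) +ᶻ y) ≡ l
    end = trans (cong c (ℤₚ.+-assoc u x y)) ue≡l
    is-h : l ≡ h → D (x +ᶻ y) ≡ D x ⊎ D (x +ᶻ y) ≡ D y
    is-h q = inj₁ (trans el (trans (cong suc q) (sym eh)))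
    is-k : l ≡ k → D (x +ᶻ y) ≡ D x ⊎ D (x +ᶻ y) ≡ D y
    is-k q = inj₂ (trans el (trans (cong suc q) (sym ek)))
    by : Through h (c u) (c (u +ᶻ x)) → Through k (c (u +ᶻ x)) (c ((u +ᶻ x) +ᶻ y)) →
      D (x +ᶻ y) ≡ D x ⊎ D (x +ᶻ y) ≡ D y
    by (inj₂ (inj₁ a)) _ = contradiction (trans (sym u≡w) a) w≢h
    by _ (inj₂ (inj₂ b)) = is-k (trans (sym end) b)
    by (inj₁ a) (inj₁ b) = contradiction (trans (sym u≡w) (trans a (trans b end))) w≢l
    by (inj₁ a) (inj₂ (inj₁ b)) = contradiction (trans (sym u≡w) (trans a b)) w≢k
    by (inj₂ (inj₂ a)) (inj₁ b) = is-h (trans (sym end) (trans (sym b) a))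
    by (inj₂ (inj₂ a)) (inj₂ (inj₁ b)) = contradiction (trans eh (trans (cong suc (trans (sym a) b)) (sym ek))) x≢y

-- Four colours would yield three different nonzero values of D, which `Ultrametric.absurd`
-- excludes.
at-most-three : ∀ {p} → Prime p → ∀ {c} → Periodic p c → RainbowFree c → ∀ {xs} → Distinct c xs → length xs ≤ 3
at-most-three {p} pp {c} per rf {xs} dis with length xs ≤? 3
... | yes l≤3 = l≤3
... | no l≰3 = ⊥-elim contradictory
  where
  4≤ : 4 ≤ length xs
  4≤ = ℕₚ.≰⇒> l≰3
  open Hubs pp per rf dis (ℕₚ.<⇒≤ 4≤)
  open Ultrametric pp D D-periodic D-multiple D-neg (D-sum 4≤)
  contradictory : ⊥
  contradictory with fresh [] (ℕₚ.≤-trans (s≤s (s≤s z≤n)) 4≤)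
  ... | d₁ , d₁≢0 , [] with D-dominant d₁ (D≢0 d₁≢0)
  ... | h₁ , e₁ , _ with fresh (h₁ ∷ []) (ℕₚ.≤-trans (s≤s (s≤s (s≤s z≤n))) 4≤)
  ... | d₂ , d₂≢0 , d₂≢d₁ ∷ [] with D-dominant d₂ (D≢0 d₂≢0)
  ... | h₂ , e₂ , _ with fresh (h₁ ∷ h₂ ∷ []) 4≤
  ... | d₃ , d₃≢0 , d₃≢d₁ ∷ d₃≢d₂ ∷ [] = absurd
    (((λ e → d₃≢d₂ (trans e e₂)) ∷ (λ e → d₃≢d₁ (trans e e₁)) ∷ []) ∷ ((λ e → d₂≢d₁ (trans e e₁)) ∷ []) ∷ [] ∷ [])
    d₃≢0 d₂≢0 d₁≢0

-- Three colours modulo an odd prime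

-- For an odd prime p such a function exists exactly if -1 and 2 do not generate the multiplicative
-- group modulo p.
record Split (p : ℕ) : Set where
  field
    f        : ℤ → ℕ
    periodic : Periodic p f
    neg      : ∀ x → f (-ᶻ x) ≡ f x
    twofold  : ∀ x → f (x +ᶻ x) ≡ f x
    a b      : ℤ
    p∤a      : ¬ + p ∣ᶻ a
    p∤b      : ¬ + p ∣ᶻ b
    separate : f a ≢ f b

three-colours⇒split : ∀ {p} → Prime p → ¬ 2 ℕ∣.∣ p → ∀ {c} → Periodic p c → RainbowFree c →
  ∀ {xs} → Distinct c xs → 3 ≤ length xs → Split p
three-colours⇒split pp odd per rf dis 3≤ = by (fresh [] (ℕₚ.≤-trans (s≤s (s≤s z≤n)) 3≤))
  where
  open Hubs pp per rf dis 3≤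
  by : ∃[ d ] (D d ≢ 0 × All (λ h → D d ≢ suc h) []) → Split _
  by (a , a≢0 , _) with D-dominant a (D≢0 a≢0)
  ... | h , e , _ with fresh (h ∷ []) 3≤
  ... | b , b≢0 , b≢a ∷ [] = record
    { f = D ; periodic = D-periodic ; neg = D-neg ; twofold = D-double odd
    ; a = a ; b = b ; p∤a = D≢0 a≢0 ; p∤b = D≢0 b≢0 ; separate = λ q → b≢a (trans (sym q) e) }

-- Deciding whether a prime splits

bit : Bool → ℕ
bit b = if b then 1 else 0

module _ (p : ℕ) .{{_ : NonZero p}} where
  indicator : Subset p → ℤ → ℕ
  indicator S x = bit (lookup S (residue x))

  indicator-periodic : ∀ S → Periodic p (indicator S)
  indicator-periodic S m = cong (λ i → bit (lookup S i)) (residue-cong m)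

  -- The two-valued form of `Split`, in which existence is a finite search over subsets of Z_p.
  Splits : Subset p → Set
  Splits S = (∀ (i : Fin p) → indicator S (-ᶻ + toℕ i) ≡ indicator S (+ toℕ i))
    × (∀ (i : Fin p) → indicator S (+ toℕ i +ᶻ + toℕ i) ≡ indicator S (+ toℕ i))
    × ∃[ i ] ∃[ j ] (¬ + p ∣ᶻ + toℕ {p} i × ¬ + p ∣ᶻ + toℕ {p} j × indicator S (+ toℕ i) ≢ indicator S (+ toℕ j))

  splits? : Decidable Splits
  splits? S = all? (λ i → _ ≟ _) ×-dec all? (λ i → _ ≟ _) ×-dec
    any? (λ i → any? (λ j → ¬? (_ ∣ᶻ? _) ×-dec ¬? (_ ∣ᶻ? _) ×-dec ¬? (_ ≟ _)))

  splits⇒split : ∀ S → Splits S → Split p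
  splits⇒split S (neg , twofold , i , j , p∤i , p∤j , i≢j) = record
    { f = f ; periodic = per
    ; neg = λ x → trans (per (mod-neg (residue-sound x))) (trans (neg (residue x)) (sym (per (residue-sound x))))
    ; twofold = λ x → trans (per (mod-+ (residue-sound x) (residue-sound x)))
        (trans (twofold (residue x)) (sym (per (residue-sound x))))
    ; a = + toℕ i ; b = + toℕ j ; p∤a = p∤i ; p∤b = p∤j ; separate = i≢j }
    where
    f : ℤ → ℕ
    f = indicator S
    per : Periodic p f
    per = indicator-periodic S

  -- The level set of f through a inherits both invariances and contains a but not b.
  split⇒splits : Split p → ∃[ S ] Splits S
  split⇒splits s = S , (λ i → agree (neg (+ toℕ i))) , (λ i → agree (twofold (+ toℕ i))) ,
      residue a , residue b , (λ d → p∤a (mod-∣ (residue-sound a) d)) , (λ d → p∤b (mod-∣ (residue-sound b) d)) ,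
      λ e → distinguished (trans (g-periodic (residue-sound a)) (trans e (sym (g-periodic (residue-sound b)))))
    where
    open Split s
    S : Subset p
    S = Vec.tabulate (λ i → does (f (+ toℕ i) ≟ f a))
    g-periodic : Periodic p (indicator S)
    g-periodic = indicator-periodic S
    value : ∀ x → indicator S x ≡ bit (does (f x ≟ f a))
    value x = cong bit (trans (lookup∘tabulate (λ i → does (f (+ toℕ i) ≟ f a)) (residue x))
                (cong (λ v → does (v ≟ f a)) (sym (periodic (residue-sound x)))))
    agree : ∀ {x y} → f x ≡ f y → indicator S x ≡ indicator S y
    agree {x} {y} e = trans (value x) (trans (cong (λ v → bit (does (v ≟ f a))) e) (sym (value y)))
    distinguished : indicator S a ≢ indicator S b
    distinguished e = by (f a ≟ f a) (f b ≟ f a) (trans (sym (value a)) (trans e (value b)))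
      where
      by : (u : Dec (f a ≡ f a)) (v : Dec (f b ≡ f a)) → bit (does u) ≢ bit (does v)
      by (yes _) (no _) ()
      by (yes _) (yes q) _ = separate (sym q)
      by (no ne) _ _ = ne refl

  split? : Dec (Split p)
  split? = map′ (λ (S , s) → splits⇒split S s) split⇒splits (anySubset? splits?)

-- Lower bounds

UpperBound : ℕ → ℕ → Set
UpperBound n u = ∀ {c} → Periodic n c → RainbowFree c → ∀ {xs} → Distinct c xs → length xs ≤ u

-- The colours are exactly 0, ..., u - 1, so that new ones can be appended from u on and surplus
-- ones can be merged by a minimum.
record LowerBound (n u : ℕ) : Set where
  field
    c        : ℤ → ℕ
    periodic : Periodic n c
    rainbowFree : RainbowFree c
    bounded  : ∀ x → c x < u
    onto     : ∀ k → k < u → ∃[ x ] c x ≡ k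

upper-unsplit : ∀ {p} → Prime p → ¬ 2 ℕ∣.∣ p → ¬ Split p → UpperBound p 2
upper-unsplit pp odd ns per rf {xs} dis with length xs ≤? 2
... | yes l≤2 = l≤2
... | no l≰2 = contradiction (three-colours⇒split pp odd per rf dis (ℕₚ.≰⇒> l≰2)) ns

two-colours : ∀ {a b c} → a < 2 → b < 2 → c < 2 → Coincide a b c
two-colours {0} {0} _ _ _ = inj₁ refl
two-colours {1} {1} _ _ _ = inj₁ refl
two-colours {0} {1} {0} _ _ _ = inj₂ (inj₁ refl)
two-colours {0} {1} {1} _ _ _ = inj₂ (inj₂ refl)
two-colours {1} {0} {0} _ _ _ = inj₂ (inj₂ refl)
two-colours {1} {0} {1} _ _ _ = inj₂ (inj₁ refl)
two-colours {suc (suc _)} (s≤s (s≤s ())) _ _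
two-colours {_} {suc (suc _)} _ (s≤s (s≤s ())) _
two-colours {_} {_} {suc (suc _)} _ _ (s≤s (s≤s ()))

lower-one : LowerBound 1 1
lower-one = record { c = λ _ → 0 ; periodic = λ _ → refl ; rainbowFree = λ _ _ _ _ → inj₁ refl
  ; bounded = λ _ → s≤s z≤n ; onto = λ { zero _ → + 0 , refl ; (suc _) (s≤s ()) } }

lower-two : LowerBound 2 2
lower-two = record { c = c ; periodic = λ m → cong toℕ (residue-cong m)
  ; rainbowFree = λ x y z _ → two-colours (bounded x) (bounded y) (bounded z)
  ; bounded = bounded ; onto = λ k k<2 → + k , trans (cong (λ j → toℕ (residue (+ j))) (sym (toℕ-fromℕ< k<2)))
      (trans (cong toℕ (residue-toℕ (fromℕ< k<2))) (toℕ-fromℕ< k<2)) }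
  where
  c : ℤ → ℕ
  c x = toℕ (residue {2} x)
  bounded : ∀ x → c x < 2
  bounded x = toℕ<n (residue x)

mod-factor : ∀ k {n x y} → Mod (k * n) x y → Mod n x y
mod-factor k (congruent d) = congruent (∣-trans (∣ᵤ⇒∣ (ℕ∣.n∣m*n k)) d)

lower-multiple : ∀ k {n u} → LowerBound n u → LowerBound (k * n) u
lower-multiple k l = record { c = c ; periodic = λ m → periodic (mod-factor k m) ; rainbowFree = rainbowFree
  ; bounded = bounded ; onto = onto }
  where open LowerBound l

coincide-swap : ∀ {a b c} → Coincide c b a → Coincide a b c
coincide-swap (inj₁ e)        = inj₂ (inj₂ (sym e))
coincide-swap (inj₂ (inj₁ e)) = inj₂ (inj₁ (sym e))
coincide-swap (inj₂ (inj₂ e)) = inj₁ (sym e)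

-- Multiples of p repeat the given colouring; all other elements get the new colours u + g.
module Extend {p : ℕ} .{{_ : NonZero p}} (odd : ¬ 2 ℕ∣.∣ p)
  (v : ℕ) (v≤2 : v ≤ 2) (g : ℤ → ℕ) (g-periodic : Periodic p g) (g-neg : ∀ x → g (-ᶻ x) ≡ g x)
  (g-double : ∀ x → g (x +ᶻ x) ≡ g x) (g-bounded : ∀ x → g x < v)
  (g-onto : ∀ k → k < v → ∃[ x ] (¬ + p ∣ᶻ x × g x ≡ k))
  {t u : ℕ} (l : LowerBound t u) where
  open LowerBound l

  abstract
    new : ℤ → ℕ
    new x with + p ∣ᶻ? x
    ... | yes d = c (_∣ᶻ_.quotient d)
    ... | no _  = u + g x

    new-multiple : ∀ {x} q → x ≡ q *ᶻ + p → new x ≡ c q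
    new-multiple {x} q e with + p ∣ᶻ? x
    ... | yes (divides q′ e′) = cong c (ℤₚ.*-cancelʳ-≡ q′ q (+ p) (trans (sym e′) e))
    ... | no p∤x = contradiction (divides q e) p∤x

    new-other : ∀ {x} → ¬ + p ∣ᶻ x → new x ≡ u + g x
    new-other {x} p∤x with + p ∣ᶻ? x
    ... | yes d = contradiction d p∤x
    ... | no _  = refl

  new-periodic : Periodic (p * t) new
  new-periodic {x} {y} m@(congruent d) = by (+ p ∣ᶻ? y)
    where
    m′ : Mod p x y
    m′ = mod-factor t (subst (λ n → Mod n x y) (ℕₚ.*-comm p t) m)
    by : Dec (+ p ∣ᶻ y) → new x ≡ new y
    by (no p∤y) = trans (new-other (λ p∣x → p∤y (mod-∣ (mod-sym m′) p∣x)))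
                        (trans (cong (λ w → u + w) (g-periodic m′)) (sym (new-other p∤y)))
    by (yes (divides q e)) = quotients d
      where
      lemma₁ : ∀ x q p → x ≡ (x -ᶻ q *ᶻ p) +ᶻ q *ᶻ p
      lemma₁ = solve-∀
      lemma₂ : ∀ q k p t → k *ᶻ (p *ᶻ t) +ᶻ q *ᶻ p ≡ (q +ᶻ k *ᶻ t) *ᶻ p
      lemma₂ = solve-∀
      lemma₃ : ∀ q k → (q +ᶻ k) -ᶻ q ≡ k
      lemma₃ = solve-∀
      quotients : + (p * t) ∣ᶻ x -ᶻ y → new x ≡ new y
      quotients (divides k e′) = trans (new-multiple (q +ᶻ k *ᶻ + t) x≡) (trans (periodic (congruent (divides k (lemma₃ q (k *ᶻ + t))))) (sym (new-multiple q e)))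
        where
        x≡ : x ≡ (q +ᶻ k *ᶻ + t) *ᶻ + p
        x≡ = trans (lemma₁ x q (+ p)) (trans (cong (_+ᶻ q *ᶻ + p) (trans (cong (λ w → x -ᶻ w) (sym e))
          (trans e′ (cong (k *ᶻ_) (ℤₚ.pos-* p t))))) (lemma₂ q k (+ p) (+ t)))

  offset : ∀ {a b c} → Coincide a b c → Coincide (u + a) (u + b) (u + c)
  offset = coincide-map (λ w → u + w)

  third-end : ∀ x y z → x +ᶻ z ≡ y +ᶻ y → z ≡ (y +ᶻ y) -ᶻ x
  third-end x y z e = trans (lemma x z) (cong (_-ᶻ x) e)
    where
    lemma : ∀ x z → z ≡ (x +ᶻ z) -ᶻ x
    lemma = solve-∀

  near : ∀ x y z → x +ᶻ z ≡ y +ᶻ y → + p ∣ᶻ x → Mod p z (y +ᶻ y)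
  near x y z e d = congruent (subst (+ p ∣ᶻ_) (sym (trans (cong (_-ᶻ (y +ᶻ y)) (third-end x y z e)) (lemma x (y +ᶻ y)))) (∣m⇒∣-m d))
    where
    lemma : ∀ x w → (w -ᶻ x) -ᶻ w ≡ -ᶻ x
    lemma = solve-∀

  -- If p divides x, then z is congruent to 2y. Either p does not divide y, and y and z get equal
  -- colours since g is invariant under doubling, or all three are multiples of p and the given
  -- colouring applies to the quotients.
  multiple-end : ∀ x y z → x +ᶻ z ≡ y +ᶻ y → + p ∣ᶻ x → Coincide (new x) (new y) (new z)
  multiple-end x y z e p∣x = by (+ p ∣ᶻ? y)
    where
    z≡2y : Mod p z (y +ᶻ y)
    z≡2y = near x y z e p∣x
    by : Dec (+ p ∣ᶻ y) → Coincide (new x) (new y) (new z)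
    by (no p∤y) = inj₂ (inj₂ (trans (new-other p∤y) (trans (cong (λ w → u + w) (sym (trans (g-periodic z≡2y) (g-double y))))
      (sym (new-other (λ p∣z → p∤y (odd-half odd (mod-∣ (mod-sym z≡2y) p∣z))))))))
    by (yes p∣y) = all-multiples p∣x p∣y (mod-∣ z≡2y (∣m∣n⇒∣m+n p∣y p∣y))
      where
      all-multiples : + p ∣ᶻ x → + p ∣ᶻ y → + p ∣ᶻ z → Coincide (new x) (new y) (new z)
      all-multiples (divides i ei) (divides j ej) (divides k ek)
        rewrite new-multiple i ei | new-multiple j ej | new-multiple k ek =
        rainbowFree i j k (ℤₚ.*-cancelʳ-≡ (i +ᶻ k) (j +ᶻ j) (+ p)
          (trans (ℤₚ.*-distribʳ-+ (+ p) i k) (trans (cong₂ _+ᶻ_ (sym ei) (sym ek))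
          (trans e (trans (cong₂ _+ᶻ_ ej ej) (sym (ℤₚ.*-distribʳ-+ (+ p) j j)))))))

  new-rainbowFree : RainbowFree new
  new-rainbowFree x y z e = by (+ p ∣ᶻ? x) (+ p ∣ᶻ? y) (+ p ∣ᶻ? z)
    where
    opposite : + p ∣ᶻ y → g x ≡ g z
    opposite p∣y = trans (g-periodic (congruent (subst (+ p ∣ᶻ_) (trans (sym e) (lemma x z)) (∣m∣n⇒∣m+n p∣y p∣y)))) (g-neg z)
      where
      lemma : ∀ x z → x +ᶻ z ≡ x -ᶻ (-ᶻ z)
      lemma = solve-∀
    by : Dec (+ p ∣ᶻ x) → Dec (+ p ∣ᶻ y) → Dec (+ p ∣ᶻ z) → Coincide (new x) (new y) (new z)
    by (yes p∣x) _ _ = multiple-end x y z e p∣x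
    by (no _) _ (yes p∣z) = coincide-swap (multiple-end z y x (trans (ℤₚ.+-comm z x) e) p∣z)
    -- The ends are opposite modulo p, and g is invariant under negation.
    by (no p∤x) (yes p∣y) (no p∤z) = inj₂ (inj₁ (trans (new-other p∤x)
      (trans (cong (λ w → u + w) (opposite p∣y)) (sym (new-other p∤z)))))
    -- Only the at most two new colours occur here.
    by (no p∤x) (no p∤y) (no p∤z) rewrite new-other p∤x | new-other p∤y | new-other p∤z =
      offset (two-colours (below x) (below y) (below z))
      where
      below : ∀ w → g w < 2
      below w = ℕₚ.≤-trans (g-bounded w) v≤2

  extended : LowerBound (p * t) (u + v)
  extended = record { c = new ; periodic = new-periodic ; rainbowFree = new-rainbowFree ; bounded = below ; onto = all }
    where
    below : ∀ x → new x < u + v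
    below x = by (+ p ∣ᶻ? x)
      where
      by : Dec (+ p ∣ᶻ x) → new x < u + v
      by (yes (divides q e)) rewrite new-multiple q e = ℕₚ.≤-trans (bounded q) (ℕₚ.m≤m+n u v)
      by (no p∤x) rewrite new-other p∤x = ℕₚ.+-monoʳ-< u (g-bounded x)
    all : ∀ k → k < u + v → ∃[ x ] new x ≡ k
    all k k<u+v with k <? u
    ... | yes k<u with onto k k<u
    ... | x , e = x *ᶻ + p , trans (new-multiple x refl) e
    all k k<u+v | no k≮u with g-onto (k ∸ u) (ℕₚ.+-cancelˡ-< u (k ∸ u) v (subst (_< u + v) (sym (ℕₚ.m+[n∸m]≡n (ℕₚ.≮⇒≥ k≮u))) k<u+v))
    ... | x , p∤x , e = x , trans (new-other p∤x) (trans (cong (λ w → u + w) e) (ℕₚ.m+[n∸m]≡n (ℕₚ.≮⇒≥ k≮u)))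

lower-odd : ∀ {p} → Prime p → ¬ 2 ℕ∣.∣ p → ∀ {t u} → LowerBound t u → LowerBound (p * t) (u + 1)
lower-odd {p} pp odd = Extend.extended odd 1 (s≤s z≤n) (λ _ → 0) (λ _ → refl) (λ _ → refl) (λ _ → refl) (λ _ → s≤s z≤n)
  λ { zero _ → + 1 , (λ d → nonTrivial⇒≢1 (ℕ∣.∣1⇒≡1 (∣⇒∣ᵤ d))) , refl ; (suc _) (s≤s ()) }
  where
  instance
    _ = prime⇒nonZero pp
    _ = prime⇒nonTrivial pp

lower-split : ∀ {p} → Prime p → ¬ 2 ℕ∣.∣ p → Split p → ∀ {t u} → LowerBound t u → LowerBound (p * t) (u + 2)
lower-split {p} pp odd s = Extend.extended odd 2 ℕₚ.≤-refl g (λ m → same (periodic m)) (λ x → same (neg x))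
  (λ x → same (twofold x)) below attained
  where
  instance _ = prime⇒nonZero pp
  open Split s
  g : ℤ → ℕ
  g x = bit (does (f x ≟ f a))
  same : ∀ {x y} → f x ≡ f y → g x ≡ g y
  same = cong (λ w → bit (does (w ≟ f a)))
  below : ∀ x → g x < 2
  below x with does (f x ≟ f a)
  ... | true  = s≤s (s≤s z≤n)
  ... | false = s≤s z≤n
  at-a : (d : Dec (f a ≡ f a)) → bit (does d) ≡ 1
  at-a (yes _) = refl
  at-a (no ne) = contradiction refl ne
  at-b : (d : Dec (f b ≡ f a)) → bit (does d) ≡ 0
  at-b (yes e) = contradiction (sym e) separate
  at-b (no _)  = refl
  attained : ∀ k → k < 2 → ∃[ x ] (¬ + p ∣ᶻ x × g x ≡ k)
  attained 0 _ = b , p∤b , at-b (f b ≟ f a)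
  attained 1 _ = a , p∤a , at-a (f a ≟ f a)
  attained (suc (suc _)) (s≤s (s≤s ()))

-- Upper bounds: an odd prime factor

-- Transfers a list of distinct colours from g to c, so that a bound for c limits those colours of g
-- that also occur in c.
represent : ∀ {g c : ℤ → ℕ} {xs} → All (λ x → ∃[ y ] c y ≡ g x) xs → Distinct g xs →
  ∃[ ys ] (Distinct c ys × length ys ≡ length xs)
represent {g} {c} all dis = All.reduce proj₁ all , distinct all dis , lengths all
  where
  lengths : ∀ {xs} (a : All (λ x → ∃[ y ] c y ≡ g x) xs) → length (All.reduce proj₁ a) ≡ length xs
  lengths [] = refl
  lengths (_ ∷ a) = cong suc (lengths a)
  apart : ∀ {k xs} (a : All (λ x → ∃[ y ] c y ≡ g x) xs) → All (λ x → k ≢ g x) xs →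
    All (λ y → k ≢ c y) (All.reduce proj₁ a)
  apart [] [] = []
  apart ((_ , e) ∷ a) (ne ∷ nes) = (λ q → ne (trans q e)) ∷ apart a nes
  distinct : ∀ {xs} (a : All (λ x → ∃[ y ] c y ≡ g x) xs) → Distinct g xs → Distinct c (All.reduce proj₁ a)
  distinct [] [] = []
  distinct ((_ , e) ∷ a) (ne ∷ dis) = All.map (λ f q → f (trans (sym e) q)) (apart a ne) ∷ distinct a dis

upper-represent : ∀ {t u} → UpperBound t u → ∀ {c} → Periodic t c → RainbowFree c →
  ∀ {g xs} → Distinct g xs → All (λ x → ∃[ y ] c y ≡ g x) xs → length xs ≤ u
upper-represent up per rf dis all with represent all dis
... | ys , dis′ , e = subst (_≤ _) e (up per rf dis′)

length-partition : ∀ {A : Set} {P : A → Set} (P? : Decidable P) xs →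
  length xs ≡ length (filter P? xs) + length (filter (¬? ∘ P?) xs)
length-partition P? [] = refl
length-partition {P = P} P? (x ∷ xs) = by (P? x)
  where
  by : Dec (P x) → suc (length xs) ≡ length (filter P? (x ∷ xs)) + length (filter (¬? ∘ P?) (x ∷ xs))
  by (yes p) rewrite filter-accept P? {xs = xs} p | filter-reject (¬? ∘ P?) {xs = xs} (λ np → np p) =
    cong suc (length-partition P? xs)
  by (no np) rewrite filter-reject P? {xs = xs} np | filter-accept (¬? ∘ P?) {xs = xs} np =
    trans (cong suc (length-partition P? xs)) (sym (ℕₚ.+-suc _ _))

halve : ∀ {n} → ¬ 2 ℕ∣.∣ n → ∀ s → ∃[ y ] Mod n (y +ᶻ y) s
halve {n} odd s with parity n
... | twice w = contradiction (2∣twice w) odd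
... | twice+1 w = (+ 1 +ᶻ + w) *ᶻ s , congruent (divides s (lemma (+ w) s))
  where
  lemma : ∀ w s → ((+ 1 +ᶻ w) *ᶻ s +ᶻ (+ 1 +ᶻ w) *ᶻ s) -ᶻ s ≡ s *ᶻ (+ 1 +ᶻ (w +ᶻ w))
  lemma = solve-∀

abstract
  reflect : ℤ → ℤ → ℤ
  reflect a z = (a +ᶻ a) -ᶻ z

  reflect-def : ∀ a z → reflect a z ≡ (a +ᶻ a) -ᶻ z
  reflect-def a z = refl

  reflect-mid : ∀ a z → z +ᶻ reflect a z ≡ a +ᶻ a
  reflect-mid = lemma
    where
    lemma : ∀ a z → z +ᶻ ((a +ᶻ a) -ᶻ z) ≡ a +ᶻ a
    lemma = solve-∀

  reflect-involutive : ∀ a z → reflect a (reflect a z) ≡ z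
  reflect-involutive = lemma
    where
    lemma : ∀ a z → (a +ᶻ a) -ᶻ ((a +ᶻ a) -ᶻ z) ≡ z
    lemma = solve-∀

  reflect-mod : ∀ {n a b y z} → Mod n a b → Mod n y z → Mod n (reflect a y) (reflect b z)
  reflect-mod m k = mod-+ (mod-+ m m) (mod-neg k)

  reflect-third : ∀ {n x y z} → Mod n (y +ᶻ y) (x +ᶻ z) → Mod n (reflect y x) z
  reflect-third {n} {x} {y} {z} m = mod-trans (mod-+ m (mod-refl (-ᶻ x))) (mod-reflexive (lemma x z))
    where
    lemma : ∀ x z → (x +ᶻ z) -ᶻ x ≡ z
    lemma = solve-∀

  reflect-composite : ∀ k x w → reflect (reflect w x) (reflect x k) ≡
    k +ᶻ (((w -ᶻ x) +ᶻ (w -ᶻ x)) +ᶻ ((w -ᶻ x) +ᶻ (w -ᶻ x)))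
  reflect-composite = lemma
    where
    lemma : ∀ k x w → (((w +ᶻ w) -ᶻ x) +ᶻ ((w +ᶻ w) -ᶻ x)) -ᶻ ((x +ᶻ x) -ᶻ k)
      ≡ k +ᶻ (((w -ᶻ x) +ᶻ (w -ᶻ x)) +ᶻ ((w -ᶻ x) +ᶻ (w -ᶻ x)))
    lemma = solve-∀

module OddStep {p t : ℕ} (pp : Prime p) (odd : ¬ 2 ℕ∣.∣ p * t)
  {c : ℤ → ℕ} (per : Periodic (p * t) c) (rf : RainbowFree c) where

  odd-p : ¬ 2 ℕ∣.∣ p
  odd-p d = odd (ℕ∣.∣-trans d (ℕ∣.m∣m*n t))

  instance
    pt≢0 : NonZero (p * t)
    pt≢0 = ≢-nonZero λ e → odd (subst (2 ℕ∣.∣_) (sym e) (2 ℕ∣.∣0))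

  mod-p : ∀ {x y} → Mod (p * t) x y → Mod p x y
  mod-p {x} {y} m = mod-factor t (subst (λ n → Mod n x y) (ℕₚ.*-comm p t) m)

  In : ℤ → ℕ → Set
  In i k = ∃[ x ] (Mod p x i × c x ≡ k)

  in-self : ∀ x → In x (c x)
  in-self x = x , mod-refl x , refl

  in-mod : ∀ {i j k} → Mod p i j → In i k → In j k
  in-mod m (x , m′ , e) = x , mod-trans m′ m , e

  in-periodic : ∀ {j x y} → Mod (p * t) x y → In j (c x) → In j (c y)
  in-periodic {j} m = subst (In j) (per m)

  mod? : ∀ x y → Dec (Mod p x y)
  mod? x y = map′ congruent Mod.difference (+ p ∣ᶻ? (x -ᶻ y))

  abstract
    in? : ∀ i k → Dec (In i k)
    in? i k = exists-mod? {p * t} (λ x → mod? x i ×-dec (c x ≟ k))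
      (λ m (a , b) → mod-trans (mod-sym (mod-p m)) a , trans (sym (per m)) b)

  -- The class of x modulo p has two colours that are missing in the class of j.
  Witness : ℤ → ℤ → ℤ → Set
  Witness x y j = Mod p y x × c x ≢ c y × ¬ In j (c x) × ¬ In j (c y)

  witness-mod : ∀ {x x′ y y′ j j′} → Mod (p * t) x x′ → Mod (p * t) y y′ → Mod (p * t) j j′ →
    Witness x y j → Witness x′ y′ j′
  witness-mod mx my mj (m , ne , nx , ny) =
    mod-trans (mod-sym (mod-p my)) (mod-trans m (mod-p mx)) ,
    (λ e → ne (trans (per mx) (trans e (sym (per my))))) ,
    (λ i → nx (in-mod (mod-sym (mod-p mj)) (in-periodic (mod-sym mx) i))) ,
    (λ i → ny (in-mod (mod-sym (mod-p mj)) (in-periodic (mod-sym my) i)))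

  abstract
    witness? : Dec (∃[ x ] ∃[ y ] ∃[ j ] Witness x y j)
    witness? = exists-mod? {p * t} (λ x → exists-mod? {p * t} (λ y → exists-mod? {p * t}
      (λ j → mod? y x ×-dec ¬? (c x ≟ c y) ×-dec ¬? (in? j (c x)) ×-dec ¬? (in? j (c y)))
      (λ m → witness-mod (mod-refl x) (mod-refl y) m))
      (λ m (j , w) → j , witness-mod (mod-refl x) m (mod-refl j) w))
      (λ m (y , j , w) → y , j , witness-mod m (mod-refl y) (mod-refl j) w)

  -- If the reflection of z in a does not keep the colour of z, it has colour c a. Reflecting it in
  -- b then leads back to the class of z, with colour c a or c b, both of which are missing there.
  mirror : ∀ {a b z} → Mod p b a → c a ≢ c b → ¬ In z (c a) → ¬ In z (c b) → c (reflect a z) ≡ c z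
  mirror {a} {b} {z} m a≢b na nb = first (rf z a (reflect a z) (reflect-mid a z))
    where
    z′ : ℤ
    z′ = reflect b (reflect a z)
    z′≡z : Mod p z′ z
    z′≡z = mod-trans (reflect-mod m (mod-refl (reflect a z))) (mod-reflexive (reflect-involutive a z))
    second : c a ≡ c (reflect a z) → Coincide (c z′) (c b) (c (reflect a z)) → c (reflect a z) ≡ c z
    second q (inj₁ e)        = contradiction (z′ , z′≡z , e) nb
    second q (inj₂ (inj₁ e)) = contradiction (z′ , z′≡z , trans e (sym q)) na
    second q (inj₂ (inj₂ e)) = contradiction (trans q (sym e)) a≢b
    first : Coincide (c z) (c a) (c (reflect a z)) → c (reflect a z) ≡ c z
    first (inj₁ e)        = contradiction (z , mod-refl z , e) na
    first (inj₂ (inj₁ e)) = sym e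
    first (inj₂ (inj₂ q)) = second q (rf z′ b (reflect a z)
      (trans (ℤₚ.+-comm z′ (reflect a z)) (reflect-mid b (reflect a z))))

  Avoid : ℕ → ℕ → ℤ → Set
  Avoid α β k = ¬ In k α × ¬ In k β

  mirror-avoid : ∀ {a b k} → Mod p b a → c a ≢ c b → Avoid (c a) (c b) k → Avoid (c a) (c b) (reflect a k)
  mirror-avoid {a} {b} {k} m a≢b (na , nb) = away na , away nb
    where
    away : ∀ {α} → ¬ In k α → ¬ In (reflect a k) α
    away nα (z , z≡ , e) = nα (reflect a z , r≡k , trans (sym back) e)
      where
      r≡k : Mod p (reflect a z) k
      r≡k = mod-trans (reflect-mod (mod-refl a) z≡) (mod-reflexive (reflect-involutive a k))
      back : c z ≡ c (reflect a z)
      back = trans (cong c (sym (reflect-involutive a z)))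
        (mirror m a≢b (λ i → na (in-mod r≡k i)) (λ i → nb (in-mod r≡k i)))

  -- If M has two colours missing in class j and i has two colours missing in class M, reflecting
  -- in M and in 2i − M moves j by 4(i − M) without changing its colours, until it arrives at M.
  incomparable : ∀ {x y j w w′} → Witness x y j → ¬ Witness w w′ x
  incomparable {x} {y} {j} {w} {w′} (m , x≢y , nx , ny) (m′ , w≢w′ , nw , nw′) =
    arrive (walk pp e p∤e j x)
    where
    d e : ℤ
    d = w -ᶻ x
    e = (d +ᶻ d) +ᶻ (d +ᶻ d)
    p∤e : ¬ + p ∣ᶻ e
    p∤e q = nw (w , congruent (odd-half odd-p {d} (odd-half odd-p {d +ᶻ d} q)) , refl)
    x₂ y₂ : ℤ
    x₂ = reflect w x
    y₂ = reflect w y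
    x₂≡ : c x₂ ≡ c x
    x₂≡ = mirror m′ w≢w′ nw nw′
    y₂≡ : c y₂ ≡ c y
    y₂≡ = mirror m′ w≢w′ (λ i → nw (in-mod m i)) (λ i → nw′ (in-mod m i))
    second : ∀ {k} → Avoid (c x) (c y) k → Avoid (c x) (c y) (reflect x₂ k)
    second {k} a = subst₂ (λ α β → Avoid α β (reflect x₂ k)) x₂≡ y₂≡
      (mirror-avoid (reflect-mod (mod-refl w) m) (λ q → x≢y (trans (sym x₂≡) (trans q y₂≡)))
        (subst₂ (λ α β → Avoid α β k) (sym x₂≡) (sym y₂≡) a))
    travel : ∀ l → Avoid (c x) (c y) (affine j e (+ l))
    travel zero = subst (Avoid (c x) (c y)) (sym (affine-zero j e)) (nx , ny)
    travel (suc l) = subst (Avoid (c x) (c y)) (trans (reflect-composite (affine j e (+ l)) x w) (affine-suc j e l))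
      (second (mirror-avoid m x≢y (travel l)))
    arrive : ∃[ l ] (l < p × Mod p (affine j e (+ l)) x) → ⊥
    arrive (l , _ , r) = proj₁ (travel l) (in-mod (mod-sym r) (in-self x))

  -- A class with two colours missing in some other class can serve as M, by `incomparable`; if
  -- there is none, any class can.
  special-from : Dec (∃[ x ] ∃[ y ] ∃[ j ] Witness x y j) → ∃[ M ] ∀ x y → ¬ Witness x y M
  special-from (yes (M , _ , _ , w)) = M , λ x y → incomparable w
  special-from (no none) = + 0 , λ x y w → none (x , y , + 0 , w)

  abstract
    special : ∃[ M ] ∀ x y → ¬ Witness x y M
    special = special-from witness?

  M : ℤ
  M = proj₁ special

  Outside : ℤ → Set
  Outside i = ∃[ x ] (Mod p x i × ¬ In M (c x))

  outside-mod : ∀ {i j} → Mod p i j → Outside i → Outside j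
  outside-mod m (x , m′ , o) = x , mod-trans m′ m , o

  unique-outside : ∀ {x y} → Mod p y x → ¬ In M (c x) → ¬ In M (c y) → c x ≡ c y
  unique-outside {x} {y} m ox oy with c x ≟ c y
  ... | yes e = e
  ... | no ne = contradiction (m , ne , ox , oy) (proj₂ special x y)

  abstract
    outside? : ∀ i → Dec (Outside i)
    outside? i = exists-mod? {p * t} (λ x → mod? x i ×-dec ¬? (in? M (c x)))
      (λ m (a , b) → mod-trans (mod-sym (mod-p m)) a , λ i → b (in-periodic (mod-sym m) i))

  value : ∀ {i} → Dec (Outside i) → ℕ
  value (yes (x , _)) = suc (c x)
  value (no _)        = 0

  value-outside : ∀ {x i} → Mod p x i → ¬ In M (c x) → (d : Dec (Outside i)) → value d ≡ suc (c x)
  value-outside m o (yes (y , m′ , o′)) = cong suc (unique-outside (mod-trans m (mod-sym m′)) o′ o)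
  value-outside {x} m o (no none) = contradiction (x , m , o) none

  value-inside : ∀ {i} → ¬ Outside i → (d : Dec (Outside i)) → value d ≡ 0
  value-inside no-o (yes o) = contradiction o no-o
  value-inside no-o (no _)  = refl

  -- The one colour of class i that is missing in M, shifted by one; 0 is the common colour of the
  -- classes without such a colour.
  quotient : ℤ → ℕ
  quotient i = value (outside? i)

  quotient-outside : ∀ {x i} → Mod p x i → ¬ In M (c x) → quotient i ≡ suc (c x)
  quotient-outside {x} {i} m o = value-outside m o (outside? i)

  quotient-inside : ∀ {i} → ¬ Outside i → quotient i ≡ 0
  quotient-inside {i} no-o = value-inside no-o (outside? i)

  quotient-periodic : Periodic p quotient
  quotient-periodic {i} {j} m = by (outside? i)
    where
    by : Dec (Outside i) → quotient i ≡ quotient j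
    by (yes (x , m′ , o)) = trans (quotient-outside m′ o) (sym (quotient-outside (mod-trans m′ m) o))
    by (no no-o) = trans (quotient-inside no-o) (sym (quotient-inside (λ o → no-o (outside-mod (mod-sym m) o))))

  -- Elements of classes x and y with colours missing in M are completed to a progression ending in
  -- class z. A coincidence with its third term shows that the colour of this term is missing in M
  -- too, so it is the label of z.
  end-middle : ∀ x y z → x +ᶻ z ≡ y +ᶻ y → Outside x → Outside y → Coincide (quotient x) (quotient y) (quotient z)
  end-middle x y z e (x′ , mx , ox) (y′ , my , oy) = by (rf x′ y′ r (reflect-mid y′ x′))
    where
    r : ℤ
    r = reflect y′ x′
    mr : Mod p r z
    mr = mod-trans (reflect-mod my mx) (reflect-third (mod-reflexive (sym e)))
    by : Coincide (c x′) (c y′) (c r) → Coincide (quotient x) (quotient y) (quotient z)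
    by (inj₁ q) = inj₁ (trans (quotient-outside mx ox) (trans (cong suc q) (sym (quotient-outside my oy))))
    by (inj₂ (inj₁ q)) = inj₂ (inj₁ (trans (quotient-outside mx ox) (trans (cong suc q)
      (sym (quotient-outside mr (subst (¬_ ∘ In M) q ox))))))
    by (inj₂ (inj₂ q)) = inj₂ (inj₂ (trans (quotient-outside my oy) (trans (cong suc q)
      (sym (quotient-outside mr (subst (¬_ ∘ In M) q oy))))))

  -- As `end-middle`, but the progression is completed by a midpoint modulo p t, which exists
  -- because p t is odd.
  ends : ∀ x y z → x +ᶻ z ≡ y +ᶻ y → Outside x → Outside z → Coincide (quotient x) (quotient y) (quotient z)
  ends x y z e (x′ , mx , ox) (z′ , mz , oz) with halve odd (x′ +ᶻ z′)
  ... | y′ , h = by (rf x′ y′ z″ (reflect-mid y′ x′))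
    where
    z″ : ℤ
    z″ = reflect y′ x′
    z″≡z′ : c z″ ≡ c z′
    z″≡z′ = per (reflect-third h)
    my : Mod p y′ y
    my = congruent (odd-half odd-p (subst (+ p ∣ᶻ_) (lemma y′ y)
      (Mod.difference (mod-trans (mod-p h) (mod-trans (mod-+ mx mz) (mod-reflexive e))))))
      where
      lemma : ∀ u v → (u +ᶻ u) -ᶻ (v +ᶻ v) ≡ (u -ᶻ v) +ᶻ (u -ᶻ v)
      lemma = solve-∀
    by : Coincide (c x′) (c y′) (c z″) → Coincide (quotient x) (quotient y) (quotient z)
    by (inj₁ q) = inj₁ (trans (quotient-outside mx ox) (trans (cong suc q)
      (sym (quotient-outside my (subst (¬_ ∘ In M) q ox)))))
    by (inj₂ (inj₁ q)) = inj₂ (inj₁ (trans (quotient-outside mx ox) (trans (cong suc (trans q z″≡z′))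
      (sym (quotient-outside mz oz)))))
    by (inj₂ (inj₂ q)) = inj₂ (inj₂ (trans (quotient-outside my (subst (¬_ ∘ In M) (sym (trans q z″≡z′)) oz))
      (trans (cong suc (trans q z″≡z′)) (sym (quotient-outside mz oz)))))

  quotient-rainbowFree : RainbowFree quotient
  quotient-rainbowFree x y z e = by (outside? x) (outside? y) (outside? z)
    where
    by : Dec (Outside x) → Dec (Outside y) → Dec (Outside z) → Coincide (quotient x) (quotient y) (quotient z)
    by (yes ox) (yes oy) _  = end-middle x y z e ox oy
    by (yes ox) _ (yes oz)  = ends x y z e ox oz
    by _ (yes oy) (yes oz)  = coincide-swap (end-middle z y x (trans (ℤₚ.+-comm z x) e) oz oy)
    by (no nx) (no ny) _    = inj₁ (trans (quotient-inside nx) (sym (quotient-inside ny)))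
    by (no nx) _ (no nz)    = inj₂ (inj₁ (trans (quotient-inside nx) (sym (quotient-inside nz))))
    by _ (no ny) (no nz)    = inj₂ (inj₂ (trans (quotient-inside ny) (sym (quotient-inside nz))))

  -- Colours occurring in class M are counted by the t-periodic colouring k ↦ c (M + k p), all
  -- others by `quotient`.
  bound : ∀ {u v} → UpperBound t u → UpperBound p (suc v) → ∀ {xs} → Distinct c xs → length xs ≤ u + v
  bound {u} {v} up-t up-p {xs} dis = subst (_≤ u + v) (sym (length-partition (λ x → in? M (c x)) xs))
    (ℕₚ.+-mono-≤ inner outer)
    where
    ins outs : List ℤ
    ins = filter (λ x → in? M (c x)) xs
    outs = filter (λ x → ¬? (in? M (c x))) xs
    c-M : ℤ → ℕ
    c-M k = c (affine M (+ p) k)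
    c-M-periodic : Periodic t c-M
    c-M-periodic {k} {l} (congruent (divides q e)) = per (subst₂ (Mod (p * t)) (sym (affine-def M (+ p) k)) (sym (affine-def M (+ p) l))
      (congruent (divides q (trans (lemma M (+ p) k l) (trans (cong (_*ᶻ + p) e) (trans (lemma′ q (+ t) (+ p)) (cong (q *ᶻ_) (sym (ℤₚ.pos-* p t)))))))))
      where
      lemma : ∀ M p k l → (M +ᶻ k *ᶻ p) -ᶻ (M +ᶻ l *ᶻ p) ≡ (k -ᶻ l) *ᶻ p
      lemma = solve-∀
      lemma′ : ∀ q t p → q *ᶻ t *ᶻ p ≡ q *ᶻ (p *ᶻ t)
      lemma′ = solve-∀
    locate : ∀ {k} → In M k → ∃[ y ] c-M y ≡ k
    locate (x , congruent (divides q e) , refl) = q , cong c (trans (affine-def M (+ p) q) (trans (cong (M +ᶻ_) (sym e)) (lemma M x)))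
      where
      lemma : ∀ M x → M +ᶻ (x -ᶻ M) ≡ x
      lemma = solve-∀
    inner : length ins ≤ u
    inner = upper-represent up-t c-M-periodic (rainbowFree-affine M (+ p) rf)
      (AllPairsₚ.filter⁺ (λ x → in? M (c x)) dis) (All.map locate (Allₚ.all-filter (λ x → in? M (c x)) xs))
    outs-outside : All (λ x → ¬ In M (c x)) outs
    outs-outside = Allₚ.all-filter (λ x → ¬? (in? M (c x))) xs
    label : ℤ → ℕ
    label x = suc (c x)
    M-inside : quotient M ≡ 0
    M-inside = quotient-inside λ (x , m , o) → o (x , m , refl)
    labelled : ∀ {ys} → All (λ x → ¬ In M (c x)) ys → Distinct label ys → Distinct quotient ys
    labelled [] [] = []
    labelled (o ∷ os) (ne ∷ dis) = apart os ne ∷ labelled os dis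
      where
      apart : ∀ {ys} → All (λ x → ¬ In M (c x)) ys → All (λ y → label _ ≢ label y) ys → All (λ y → quotient _ ≢ quotient y) ys
      apart [] [] = []
      apart (o′ ∷ os) (ne ∷ nes) = (λ e → ne (trans (sym (quotient-outside (mod-refl _) o))
        (trans e (quotient-outside (mod-refl _) o′)))) ∷ apart os nes
    outer : length outs ≤ v
    -- M has `quotient` 0 and is prepended to `outs`: this extra colour turns the bound `suc v` into
    -- v.
    outer = ℕₚ.≤-pred (up-p quotient-periodic quotient-rainbowFree {M ∷ outs}
      (All.map (λ o e → ℕₚ.0≢1+n (trans (sym M-inside) (trans e (quotient-outside (mod-refl _) o)))) outs-outside
       ∷ labelled outs-outside (AllPairs.map (λ ne e → ne (ℕₚ.suc-injective e))
           (AllPairsₚ.filter⁺ (λ x → ¬? (in? M (c x))) dis))))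

upper-odd : ∀ {p t u v} → Prime p → ¬ 2 ℕ∣.∣ p * t → UpperBound t u → UpperBound p (suc v) → UpperBound (p * t) (u + v)
upper-odd pp odd up-t up-p per rf = OddStep.bound pp odd per rf up-t up-p

-- Upper bounds: a factor 2

parityᶻ : ∀ x → (∃[ y ] x ≡ y +ᶻ y) ⊎ (∃[ y ] x ≡ + 1 +ᶻ (y +ᶻ y))
parityᶻ (+ n) with parity n
... | twice w   = inj₁ (+ w , refl)
... | twice+1 w = inj₂ (+ w , refl)
parityᶻ -[1+ n ] with parity n
... | twice w   = inj₂ (-[1+ w ] , refl)
... | twice+1 w = inj₁ (-[1+ w ] , refl)

module TwoStep {t : ℕ} .{{_ : NonZero t}} {c : ℤ → ℕ} (per : Periodic (2 * t) c) (rf : RainbowFree c) where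

  instance
    2t≢0 : NonZero (2 * t)
    2t≢0 = ℕₚ.m*n≢0 2 t

  doubled-mod : ∀ {x y} → Mod t x y → Mod (2 * t) (x +ᶻ x) (y +ᶻ y)
  doubled-mod {x} {y} (congruent (divides q e)) = congruent (divides q (trans (lemma x y) (trans (cong (+ 2 *ᶻ_) e)
    (trans (lemma′ q (+ t)) (cong (q *ᶻ_) (sym (ℤₚ.pos-* 2 t)))))))
    where
    lemma : ∀ x y → (x +ᶻ x) -ᶻ (y +ᶻ y) ≡ + 2 *ᶻ (x -ᶻ y)
    lemma = solve-∀
    lemma′ : ∀ q t → + 2 *ᶻ (q *ᶻ t) ≡ q *ᶻ (+ 2 *ᶻ t)
    lemma′ = solve-∀

  double-mid : ∀ {x y z} → x +ᶻ z ≡ y +ᶻ y → (x +ᶻ x) +ᶻ (z +ᶻ z) ≡ (y +ᶻ y) +ᶻ (y +ᶻ y)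
  double-mid {x} {y} {z} e = trans (lemma x z) (cong₂ _+ᶻ_ e e)
    where
    lemma : ∀ x z → (x +ᶻ x) +ᶻ (z +ᶻ z) ≡ (x +ᶻ z) +ᶻ (x +ᶻ z)
    lemma = solve-∀

  evens odds : ℤ → ℕ
  evens y = c (y +ᶻ y)
  odds y = c (+ 1 +ᶻ (y +ᶻ y))

  evens-periodic : Periodic t evens
  evens-periodic m = per (doubled-mod m)

  odds-periodic : Periodic t odds
  odds-periodic m = per (mod-+ (mod-refl (+ 1)) (doubled-mod m))

  evens-rainbowFree : RainbowFree evens
  evens-rainbowFree x y z e = rf (x +ᶻ x) (y +ᶻ y) (z +ᶻ z) (double-mid {x} {y} {z} e)

  odds-rainbowFree : RainbowFree odds
  odds-rainbowFree x y z e = rainbowFree-shift (+ 1) rf (x +ᶻ x) (y +ᶻ y) (z +ᶻ z) (double-mid {x} {y} {z} e)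

  EvenColour OddColour : ℕ → Set
  EvenColour k = ∃[ y ] evens y ≡ k
  OddColour k = ∃[ y ] odds y ≡ k

  abstract
    even? : Decidable EvenColour
    even? k = exists-mod? {t} (λ y → evens y ≟ k) (λ m e → trans (sym (evens-periodic m)) e)

    odd? : Decidable OddColour
    odd? k = exists-mod? {t} (λ y → odds y ≟ k) (λ m e → trans (sym (odds-periodic m)) e)

  module Conflict {a g : ℤ} (a-even : ¬ OddColour (c a)) (g-odd : ¬ EvenColour (c g)) where

    α γ : ℕ
    α = c a
    γ = c g

    α⇒even : ∀ {x} → c x ≡ α → ∃[ y ] x ≡ y +ᶻ y
    α⇒even {x} e with parityᶻ x
    ... | inj₁ p = p
    ... | inj₂ (y , refl) = contradiction (y , e) a-even

    γ⇒not-even : ∀ {x} y → c x ≡ γ → x ≢ y +ᶻ y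
    γ⇒not-even y e refl = g-odd (y , e)

    α≢γ : α ≢ γ
    α≢γ e with α⇒even {a} refl
    ... | y , p = γ⇒not-even y e p

    -- Since x is even, so is its reflection, which therefore cannot have colour γ.
    third-α : ∀ {x y} → c x ≡ α → c y ≡ γ → c (reflect y x) ≡ α
    third-α {x} {y} cx cy with α⇒even {x} cx
    ... | w , refl with rf x y (reflect y x) (reflect-mid y x)
    ... | inj₁ e = contradiction (trans (sym cx) (trans e cy)) α≢γ
    ... | inj₂ (inj₁ e) = trans (sym e) cx
    ... | inj₂ (inj₂ e) = contradiction (trans (reflect-def y x) (lemma y w)) (γ⇒not-even (y -ᶻ w) (trans (sym e) cy))
      where
      lemma : ∀ y w → (y +ᶻ y) -ᶻ (w +ᶻ w) ≡ (y -ᶻ w) +ᶻ (y -ᶻ w)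
      lemma = solve-∀

    -- A reflection of colour α would be even, and reflecting back would make x even.
    third-γ : ∀ {x y} → c x ≡ γ → c y ≡ α → c (reflect y x) ≡ γ
    third-γ {x} {y} cx cy with rf x y (reflect y x) (reflect-mid y x)
    ... | inj₁ e = contradiction (sym (trans (sym cx) (trans e cy))) α≢γ
    ... | inj₂ (inj₁ e) = trans (sym e) cx
    ... | inj₂ (inj₂ e) with α⇒even (trans (sym e) cy)
    ... | w , p = contradiction (trans (sym (reflect-involutive y x)) (trans (cong (reflect y) p) (trans (reflect-def y (w +ᶻ w)) (lemma y w))))
                    (γ⇒not-even (y -ᶻ w) cx)
      where
      lemma : ∀ y w → (y +ᶻ y) -ᶻ (w +ᶻ w) ≡ (y -ᶻ w) +ᶻ (y -ᶻ w)
      lemma = solve-∀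

    Pair : ℕ → ℤ → Set
    Pair k x = (c x ≡ α × c (x +ᶻ + k) ≡ γ) ⊎ (c x ≡ γ × c (x +ᶻ + k) ≡ α)

    pair-periodic : ∀ {k x y} → Mod (2 * t) x y → Pair k x → Pair k y
    pair-periodic {k} m (inj₁ (p , q)) = inj₁ (trans (sym (per m)) p , trans (sym (per (mod-+ m (mod-refl (+ k))))) q)
    pair-periodic {k} m (inj₂ (p , q)) = inj₂ (trans (sym (per m)) p , trans (sym (per (mod-+ m (mod-refl (+ k))))) q)

    abstract
      pair? : Decidable (λ k → ∃[ x ] Pair k x)
      pair? k = exists-mod? {2 * t} (λ x → (c x ≟ α ×-dec c (x +ᶻ + k) ≟ γ) ⊎-dec (c x ≟ γ ×-dec c (x +ᶻ + k) ≟ α)) pair-periodic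

    add-residue : ∀ x y → Mod (2 * t) (x +ᶻ + toℕ (residue {2 * t} (y -ᶻ x))) y
    add-residue x y = mod-trans (mod-+ (mod-refl x) (mod-sym (residue-sound (y -ᶻ x)))) (mod-reflexive (lemma x y))
      where
      lemma : ∀ x y → x +ᶻ (y -ᶻ x) ≡ y
      lemma = solve-∀

    abstract
      closest : ∃[ N ] ((∃[ x ] Pair N x) × ∀ i → i < N → ¬ (∃[ x ] Pair i x))
      closest = by (least pair? (toℕ (residue {2 * t} (g -ᶻ a))) (a , inj₁ (refl , per (add-residue a g))))
        where
        by : ∀ {k} → ∃[ N ] (N ≤ k × (∃[ x ] Pair N x) × (∀ i → i < N → ¬ (∃[ x ] Pair i x))) →
          ∃[ N ] ((∃[ x ] Pair N x) × ∀ i → i < N → ¬ (∃[ x ] Pair i x))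
        by (N , _ , p , m) = N , p , m

    N : ℕ
    N = proj₁ closest

    minimal : ∀ i → i < N → ¬ (∃[ x ] Pair i x)
    minimal = proj₂ (proj₂ closest)

    forward : ∀ x → reflect (x +ᶻ + N) x ≡ (x +ᶻ + N) +ᶻ + N
    forward x = trans (reflect-def (x +ᶻ + N) x) (lemma x (+ N))
      where
      lemma : ∀ x n → ((x +ᶻ n) +ᶻ (x +ᶻ n)) -ᶻ x ≡ (x +ᶻ n) +ᶻ n
      lemma = solve-∀

    orient : ∃[ x ] Pair N x → ∃[ x ] (c x ≡ α × c (x +ᶻ + N) ≡ γ)
    orient (x , inj₁ p) = x , p
    -- A pair that starts with γ is replaced by the pair N further on.
    orient (x , inj₂ (p , q)) = x +ᶻ + N , q , trans (cong c (sym (forward x))) (third-γ p q)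

    abstract
      oriented : ∃[ x ] (c x ≡ α × c (x +ᶻ + N) ≡ γ)
      oriented = orient (proj₁ (proj₂ closest))

    s : ℤ
    s = proj₁ oriented

    s-α : c s ≡ α
    s-α = proj₁ (proj₂ oriented)

    N≢0 : N ≢ 0
    N≢0 e = α≢γ (trans (sym s-α) (trans (cong c (sym (trans (cong (λ k → s +ᶻ + k) e) (ℤₚ.+-identityʳ s)))) (proj₂ (proj₂ oriented))))

    instance
      N-nonZero : NonZero N
      N-nonZero = ≢-nonZero N≢0

    alternate : ∀ q → Pair N (affine s (+ N) (+ q))
    alternate zero = inj₁ (trans (cong c (affine-zero s (+ N))) s-α ,
      trans (cong (λ x → c (x +ᶻ + N)) (affine-zero s (+ N))) (proj₂ (proj₂ oriented)))
    alternate (suc q) = subst (Pair N) (affine-suc s (+ N) q) (next (alternate q))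
      where
      next : ∀ {x} → Pair N x → Pair N (x +ᶻ + N)
      next {x} (inj₁ (p , q)) = inj₂ (q , trans (cong c (sym (forward x))) (third-α p q))
      next {x} (inj₂ (p , q)) = inj₁ (q , trans (cong c (sym (forward x))) (third-γ p q))

    AlphaGamma : ℤ → Set
    AlphaGamma x = c x ≡ α ⊎ c x ≡ γ

    -- An element strictly between consecutive terms of s + ℕN is closer than N to both, and they have opposite colours.
    between : ∀ {x} f h → f + h ≡ N → 1 ≤ f → 1 ≤ h → Pair N x → ¬ AlphaGamma (x +ᶻ + f)
    between {x} f h e 1≤f 1≤h pair = by pair
      where
      f<N : f < N
      f<N = subst (f <_) e (ℕₚ.m<m+n f 1≤h)
      h<N : h < N
      h<N = subst (h <_) (trans (ℕₚ.+-comm h f) e) (ℕₚ.m<m+n h 1≤f)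
      upper : (x +ᶻ + f) +ᶻ + h ≡ x +ᶻ + N
      upper = trans (ℤₚ.+-assoc x (+ f) (+ h)) (cong (λ k → x +ᶻ + k) e)
      by : Pair N x → ¬ AlphaGamma (x +ᶻ + f)
      by (inj₁ (p , q)) (inj₁ r) = minimal h h<N (x +ᶻ + f , inj₁ (r , trans (cong c upper) q))
      by (inj₁ (p , q)) (inj₂ r) = minimal f f<N (x , inj₁ (p , r))
      by (inj₂ (p , q)) (inj₁ r) = minimal f f<N (x , inj₂ (p , r))
      by (inj₂ (p , q)) (inj₂ r) = minimal h h<N (x +ᶻ + f , inj₂ (r , trans (cong c upper) q))

    -- A nonzero remainder of r modulo N would place s + r strictly between consecutive terms of s +
    -- ℕN.
    multiple-only : ∀ r → AlphaGamma (s +ᶻ + r) → N ℕ∣.∣ r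
    multiple-only r ag = by (r % N) refl
      where
      place : ∀ k → r % N ≡ k → affine s (+ N) (+ (r / N)) +ᶻ + k ≡ s +ᶻ + r
      place k e = trans (cong (_+ᶻ + k) (affine-def s (+ N) (+ (r / N)))) (trans (lemma s (+ (r / N)) (+ N) (+ k))
        (cong (s +ᶻ_) (trans (cong (+ k +ᶻ_) (sym (ℤₚ.pos-* (r / N) N)))
          (cong +_ (trans (cong (_+ r / N * N) (sym e)) (sym (m≡m%n+[m/n]*n r N)))))))
        where
        lemma : ∀ s q n k → (s +ᶻ q *ᶻ n) +ᶻ k ≡ s +ᶻ (k +ᶻ q *ᶻ n)
        lemma = solve-∀
      by : ∀ k → r % N ≡ k → N ℕ∣.∣ r
      by zero e = ℕ∣.m%n≡0⇒n∣m r N e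
      by (suc k) e = contradiction (subst AlphaGamma (sym (place (suc k) e)) ag)
        (between (suc k) (N ∸ suc k) (ℕₚ.m+[n∸m]≡n (ℕₚ.<⇒≤ k<N)) (s≤s z≤n) (ℕₚ.m<n⇒0<n∸m k<N) (alternate (r / N)))
        where
        k<N : suc k < N
        k<N = subst (_< N) e (m%n<n r N)

    -- By periodicity s + 2t has colour α, like s.
    N∣2t : N ℕ∣.∣ 2 * t
    N∣2t = multiple-only (2 * t) (inj₁ (trans (per (congruent (divides (+ 1) (trans (lemma s (+ (2 * t))) (sym (ℤₚ.*-identityˡ _)))))) s-α))
      where
      lemma : ∀ s n → (s +ᶻ n) -ᶻ s ≡ n
      lemma = solve-∀

    mod-N : ∀ {x y} → Mod (2 * t) x y → Mod N x y
    mod-N (congruent d) = congruent (∣-trans (∣ᵤ⇒∣ N∣2t) d)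

    αγ⇒multiple : ∀ {x} → AlphaGamma x → + N ∣ᶻ x -ᶻ s
    αγ⇒multiple {x} ag = mod-∣ (mod-N (residue-sound (x -ᶻ s)))
      (∣ᵤ⇒∣ (multiple-only r (subst (λ k → k ≡ α ⊎ k ≡ γ) (sym (per (add-residue s x))) ag)))
      where
      r : ℕ
      r = toℕ (residue {2 * t} (x -ᶻ s))

    multiple⇒αγ : ∀ {x} → + N ∣ᶻ x -ᶻ s → AlphaGamma x
    multiple⇒αγ {x} d = by (∣⇒∣ᵤ (mod-∣ (mod-N (mod-sym (residue-sound (x -ᶻ s)))) d))
      where
      r : ℕ
      r = toℕ (residue {2 * t} (x -ᶻ s))
      by : N ℕ∣.∣ r → AlphaGamma x
      by (ℕ∣.divides q e) = from (alternate q)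
        where
        position : c (affine s (+ N) (+ q)) ≡ c x
        position = trans (cong c (trans (affine-def s (+ N) (+ q)) (cong (s +ᶻ_) (trans (sym (ℤₚ.pos-* q N)) (cong +_ (sym e)))))) (per (add-residue s x))
        from : Pair N (affine s (+ N) (+ q)) → AlphaGamma x
        from (inj₁ (p , _)) = inj₁ (trans (sym position) p)
        from (inj₂ (p , _)) = inj₂ (trans (sym position) p)

    s₀ : ℤ
    s₀ = proj₁ (α⇒even s-α)

    s≡ : s ≡ s₀ +ᶻ s₀
    s≡ = proj₂ (α⇒even s-α)

    g₁ : ℤ
    g₁ = s +ᶻ + N

    g₁-γ : c g₁ ≡ γ
    g₁-γ = proj₂ (proj₂ oriented)

    -- s is even and s + N, having colour γ, is not.
    N-odd : ¬ 2 ℕ∣.∣ N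
    N-odd d = even (∣ᵤ⇒∣ {+ 2} {+ N} d)
      where
      even : ¬ + 2 ∣ᶻ + N
      even (divides q e) = γ⇒not-even (s₀ +ᶻ q) g₁-γ (trans (cong₂ _+ᶻ_ s≡ e) (lemma s₀ q))
        where
        lemma : ∀ s q → (s +ᶻ s) +ᶻ q *ᶻ + 2 ≡ (s +ᶻ q) +ᶻ (s +ᶻ q)
        lemma = solve-∀

    -- Midpoints with two elements of colour γ that are 2N apart have different parities.
    even-unless-γ : ∀ x → c x ≢ γ → EvenColour (c x)
    even-unless-γ x x≢γ with parityᶻ x
    ... | inj₁ (y , refl) = y , refl
    ... | inj₂ (k , refl) with parityᶻ g₁
    ... | inj₁ (j , e) = contradiction e (γ⇒not-even j g₁-γ)
    ... | inj₂ (j , e) = by (parityᶻ m)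
      where
      m m′ g₃ : ℤ
      m = + 1 +ᶻ (k +ᶻ j)
      m′ = m +ᶻ + N
      g₃ = (g₁ +ᶻ + N) +ᶻ + N
      mid : (+ 1 +ᶻ (k +ᶻ k)) +ᶻ g₁ ≡ m +ᶻ m
      mid = trans (cong (+ 1 +ᶻ (k +ᶻ k) +ᶻ_) e) (lemma k j)
        where
        lemma : ∀ k j → (+ 1 +ᶻ (k +ᶻ k)) +ᶻ (+ 1 +ᶻ (j +ᶻ j)) ≡ (+ 1 +ᶻ (k +ᶻ j)) +ᶻ (+ 1 +ᶻ (k +ᶻ j))
        lemma = solve-∀
      mid′ : (+ 1 +ᶻ (k +ᶻ k)) +ᶻ g₃ ≡ m′ +ᶻ m′
      mid′ = trans (lemma (+ 1 +ᶻ (k +ᶻ k)) g₁ (+ N)) (trans (cong (λ w → w +ᶻ + N +ᶻ + N) mid) (lemma′ m (+ N)))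
        where
        lemma : ∀ x g n → x +ᶻ ((g +ᶻ n) +ᶻ n) ≡ (x +ᶻ g) +ᶻ n +ᶻ n
        lemma = solve-∀
        lemma′ : ∀ m n → (m +ᶻ m) +ᶻ n +ᶻ n ≡ (m +ᶻ n) +ᶻ (m +ᶻ n)
        lemma′ = solve-∀
      g₃-γ : c g₃ ≡ γ
      g₃-γ = trans (cong c (sym (forward g₁))) (third-γ g₁-γ (trans (cong c (sym (forward s))) (third-α s-α g₁-γ)))
      settle : ∀ {w v} y → w ≡ y +ᶻ y → c v ≡ γ → Coincide (odds k) (c w) (c v) → EvenColour (odds k)
      settle y _ v-γ (inj₂ (inj₁ q)) = contradiction (trans q v-γ) x≢γ
      settle y w≡ v-γ (inj₂ (inj₂ q)) = contradiction w≡ (γ⇒not-even y (trans q v-γ))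
      settle y w≡ _ (inj₁ q) = y , trans (cong c (sym w≡)) (sym q)
      by : (∃[ y ] m ≡ y +ᶻ y) ⊎ (∃[ y ] m ≡ + 1 +ᶻ (y +ᶻ y)) → EvenColour (odds k)
      by (inj₁ (y , p)) = settle y p g₁-γ (rf _ m g₁ mid)
      by (inj₂ (y , p)) with parityᶻ (+ N)
      ... | inj₁ (w , q) = contradiction (∣⇒∣ᵤ (divides w (trans q (lemma w)))) N-odd
        where
        lemma : ∀ w → w +ᶻ w ≡ w *ᶻ + 2
        lemma = solve-∀
      ... | inj₂ (w , q) = settle (+ 1 +ᶻ (y +ᶻ w)) (trans (cong₂ _+ᶻ_ p q) (lemma y w)) g₃-γ (rf _ m′ g₃ mid′)
        where
        lemma : ∀ y w → (+ 1 +ᶻ (y +ᶻ y)) +ᶻ (+ 1 +ᶻ (w +ᶻ w)) ≡ (+ 1 +ᶻ (y +ᶻ w)) +ᶻ (+ 1 +ᶻ (y +ᶻ w))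
        lemma = solve-∀

    -- Discarding γ costs at most one element, and all remaining colours occur on even elements.
    bound-suc : ∀ {u} → UpperBound t u → ∀ {xs} → Distinct c xs → length xs ≤ suc u
    bound-suc {u} up {xs} dis = ℕₚ.≤-trans (length-off c γ dis) (s≤s (upper-represent up evens-periodic evens-rainbowFree
      (AllPairsₚ.filter⁺ (off? c γ) dis) (All.map (λ {x} → even-unless-γ x) (Allₚ.all-filter (off? c γ) xs))))

    module _ (t-even : 2 ℕ∣.∣ t) where

      -- On the even elements α occupies the halves congruent to s₀ modulo N. Those at odd distance
      -- from s₀ are recoloured γ, so that α and γ alternate as they do on s + Nℤ.
      Flip : ℤ → Set
      Flip y = evens y ≡ α × ¬ + 2 ∣ᶻ y -ᶻ s₀

      flip? : Decidable Flip
      flip? y = (evens y ≟ α) ×-dec ¬? (+ 2 ∣ᶻ? (y -ᶻ s₀))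

      value : ∀ y → Dec (Flip y) → ℕ
      value y (yes _) = γ
      value y (no _)  = evens y

      value-flip : ∀ y → Flip y → (d : Dec (Flip y)) → value y d ≡ γ
      value-flip y f (yes _) = refl
      value-flip y f (no nf) = contradiction f nf

      value-keep : ∀ y → ¬ Flip y → (d : Dec (Flip y)) → value y d ≡ evens y
      value-keep y nf (yes f) = contradiction f nf
      value-keep y nf (no _)  = refl

      abstract
        φ : ℤ → ℕ
        φ y = value y (flip? y)

        φ-flip : ∀ y → Flip y → φ y ≡ γ
        φ-flip y f = value-flip y f (flip? y)

        φ-keep : ∀ y → ¬ Flip y → φ y ≡ evens y
        φ-keep y nf = value-keep y nf (flip? y)

      flip-mod : ∀ {x y} → Mod t x y → Flip x → Flip y
      flip-mod {x} {y} m@(congruent d) (e , o) = trans (sym (evens-periodic m)) e , λ q → o (mod-∣ shifted q)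
        where
        shifted : Mod 2 (x -ᶻ s₀) (y -ᶻ s₀)
        -- The parity of x - s₀ is well defined modulo t because t is even.
        shifted = mod-+ {2} {x} {y} (congruent (∣-trans (∣ᵤ⇒∣ t-even) d)) (mod-refl (-ᶻ s₀))

      φ-periodic : Periodic t φ
      φ-periodic {x} {y} m = by (flip? x)
        where
        by : Dec (Flip x) → φ x ≡ φ y
        by (yes f) = trans (φ-flip x f) (sym (φ-flip y (flip-mod m f)))
        by (no nf) = trans (φ-keep x nf) (trans (evens-periodic m) (sym (φ-keep y (λ f → nf (flip-mod (mod-sym m) f)))))

      A : ℤ → Set
      A w = + N ∣ᶻ w -ᶻ s₀

      α⇒A : ∀ w → evens w ≡ α → A w
      α⇒A w e = odd-half N-odd {w -ᶻ s₀} (subst (+ N ∣ᶻ_) (trans (cong (λ v → (w +ᶻ w) -ᶻ v) s≡) (lemma w s₀)) (αγ⇒multiple {w +ᶻ w} (inj₁ e)))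
        where
        lemma : ∀ w s → (w +ᶻ w) -ᶻ (s +ᶻ s) ≡ (w -ᶻ s) +ᶻ (w -ᶻ s)
        lemma = solve-∀

      A⇒α : ∀ w → A w → evens w ≡ α
      A⇒α w d = by (multiple⇒αγ {w +ᶻ w} (subst (+ N ∣ᶻ_) (trans (lemma w s₀) (cong (λ v → (w +ᶻ w) -ᶻ v) (sym s≡))) (∣m∣n⇒∣m+n d d)))
        where
        lemma : ∀ w s → (w -ᶻ s) +ᶻ (w -ᶻ s) ≡ (w +ᶻ w) -ᶻ (s +ᶻ s)
        lemma = solve-∀
        by : AlphaGamma (w +ᶻ w) → evens w ≡ α
        by (inj₁ e) = e
        by (inj₂ e) = contradiction refl (γ⇒not-even w e)

      φ-A : ∀ w → A w → φ w ≡ α ⊎ φ w ≡ γ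
      φ-A w d = by (flip? w)
        where
        by : Dec (Flip w) → φ w ≡ α ⊎ φ w ≡ γ
        by (yes f) = inj₂ (φ-flip w f)
        by (no nf) = inj₁ (trans (φ-keep w nf) (A⇒α w d))

      φ-other : ∀ w → evens w ≢ α → φ w ≡ evens w
      φ-other w ne = φ-keep w (λ (e , _) → ne e)

      pigeonhole : ∀ {i j k} → i ≡ α ⊎ i ≡ γ → j ≡ α ⊎ j ≡ γ → k ≡ α ⊎ k ≡ γ → Coincide i j k
      pigeonhole (inj₁ p) (inj₁ q) _        = inj₁ (trans p (sym q))
      pigeonhole (inj₂ p) (inj₂ q) _        = inj₁ (trans p (sym q))
      pigeonhole (inj₁ p) (inj₂ q) (inj₁ r) = inj₂ (inj₁ (trans p (sym r)))
      pigeonhole (inj₁ p) (inj₂ q) (inj₂ r) = inj₂ (inj₂ (trans q (sym r)))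
      pigeonhole (inj₂ p) (inj₁ q) (inj₁ r) = inj₂ (inj₂ (trans q (sym r)))
      pigeonhole (inj₂ p) (inj₁ q) (inj₂ r) = inj₂ (inj₁ (trans p (sym r)))

      -- A coincidence in a colour other than α survives the recolouring. If two terms have colour
      -- α, both lie in the class `A` modulo the odd number N, hence so does the third, and the
      -- three terms share the two colours α and γ.
      φ-rainbowFree : RainbowFree φ
      φ-rainbowFree x y z e = by (evens-rainbowFree x y z e)
        where
        sums : (x -ᶻ s₀) +ᶻ (z -ᶻ s₀) ≡ (y -ᶻ s₀) +ᶻ (y -ᶻ s₀)
        sums = trans (lemma x z s₀) (trans (cong (_-ᶻ (s₀ +ᶻ s₀)) e) (sym (lemma y y s₀)))
          where
          lemma : ∀ x z s → (x -ᶻ s) +ᶻ (z -ᶻ s) ≡ (x +ᶻ z) -ᶻ (s +ᶻ s)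
          lemma = solve-∀
        cancel : ∀ a b → (a +ᶻ b) -ᶻ a ≡ b
        cancel = solve-∀
        all : A x → A y → A z → Coincide (φ x) (φ y) (φ z)
        all ax ay az = pigeonhole (φ-A x ax) (φ-A y ay) (φ-A z az)
        A-z : A x → A y → A z
        A-z ax ay = subst (+ N ∣ᶻ_) (trans (cong (_-ᶻ (x -ᶻ s₀)) (sym sums)) (cancel (x -ᶻ s₀) (z -ᶻ s₀)))
          (∣m∣n⇒∣m-n (∣m∣n⇒∣m+n ay ay) ax)
        A-x : A y → A z → A x
        A-x ay az = subst (+ N ∣ᶻ_) (trans (cong (_-ᶻ (z -ᶻ s₀)) (trans (sym sums) (ℤₚ.+-comm (x -ᶻ s₀) (z -ᶻ s₀)))) (cancel (z -ᶻ s₀) (x -ᶻ s₀)))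
          (∣m∣n⇒∣m-n (∣m∣n⇒∣m+n ay ay) az)
        A-y : A x → A z → A y
        A-y ax az = odd-half N-odd {y -ᶻ s₀} (subst (+ N ∣ᶻ_) sums (∣m∣n⇒∣m+n ax az))
        by : Coincide (evens x) (evens y) (evens z) → Coincide (φ x) (φ y) (φ z)
        by (inj₁ q) with evens x ≟ α
        ... | no ne = inj₁ (trans (φ-other x ne) (trans q (sym (φ-other y (λ r → ne (trans q r))))))
        ... | yes r = all (α⇒A x r) (α⇒A y (trans (sym q) r)) (A-z (α⇒A x r) (α⇒A y (trans (sym q) r)))
        by (inj₂ (inj₁ q)) with evens x ≟ α
        ... | no ne = inj₂ (inj₁ (trans (φ-other x ne) (trans q (sym (φ-other z (λ r → ne (trans q r)))))))
        ... | yes r = all (α⇒A x r) (A-y (α⇒A x r) (α⇒A z (trans (sym q) r))) (α⇒A z (trans (sym q) r))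
        by (inj₂ (inj₂ q)) with evens y ≟ α
        ... | no ne = inj₂ (inj₂ (trans (φ-other y ne) (trans q (sym (φ-other z (λ r → ne (trans q r)))))))
        ... | yes r = all (A-x (α⇒A y r) (α⇒A z (trans (sym q) r))) (α⇒A y r) (α⇒A z (trans (sym q) r))

      attained : ∀ x → ∃[ y ] φ y ≡ c x
      attained x = by (c x ≟ γ) (c x ≟ α)
        where
        by : Dec (c x ≡ γ) → Dec (c x ≡ α) → ∃[ y ] φ y ≡ c x
        -- The double of s₀ + N is s + 2N, of colour α, and N is odd, so this element is recoloured
        -- γ.
        by (yes e) _ = s₀ +ᶻ + N , trans (φ-flip (s₀ +ᶻ + N) (at-α , not-even)) (sym e)
          where
          lemma : ∀ s n → (s +ᶻ n) +ᶻ (s +ᶻ n) ≡ ((s +ᶻ s) +ᶻ n) +ᶻ n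
          lemma = solve-∀
          lemma′ : ∀ s n → (s +ᶻ n) -ᶻ s ≡ n
          lemma′ = solve-∀
          at-α : evens (s₀ +ᶻ + N) ≡ α
          at-α = trans (cong c (trans (lemma s₀ (+ N)) (trans (cong (λ v → (v +ᶻ + N) +ᶻ + N) (sym s≡)) (sym (forward s))))) (third-α s-α g₁-γ)
          not-even : ¬ + 2 ∣ᶻ (s₀ +ᶻ + N) -ᶻ s₀
          not-even d = N-odd (∣⇒∣ᵤ (subst (+ 2 ∣ᶻ_) (lemma′ s₀ (+ N)) d))
        by (no _) (yes e) = s₀ , trans (φ-keep s₀ (λ (_ , o) → o (divides (+ 0) (ℤₚ.+-inverseʳ s₀))))
          (trans (cong c (sym s≡)) (trans s-α (sym e)))
        by (no nγ) (no nα) with even-unless-γ x nγ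
        ... | y , e = y , trans (φ-other y (λ r → nα (trans (sym e) r))) e

      bound-same : ∀ {u} → UpperBound t u → ∀ {xs} → Distinct c xs → length xs ≤ u
      bound-same up dis = upper-represent up φ-periodic φ-rainbowFree dis (All.universal attained _)

  module _ {u} (up : UpperBound t u) {xs : List ℤ} (dis : Distinct c xs) where

    -- Either all colours occur on even elements, or all on odd ones, or some colour is missing on
    -- each side. The arbitrary `Goal` lets both bounds for 2t share this distinction.
    cases : {Goal : Set} → (length xs ≤ u → Goal) → (∀ {a g} → ¬ OddColour (c a) → ¬ EvenColour (c g) → Goal) → Goal
    cases small conflict with All.all? (even? ∘ c) xs | All.all? (odd? ∘ c) xs
    ... | yes all | _ = small (upper-represent up evens-periodic evens-rainbowFree dis all)
    ... | no _ | yes all = small (upper-represent up odds-periodic odds-rainbowFree dis all)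
    ... | no ne | no no′ with satisfied (Allₚ.¬All⇒Any¬ (odd? ∘ c) xs no′) | satisfied (Allₚ.¬All⇒Any¬ (even? ∘ c) xs ne)
    ... | a , a-even | g , g-odd = conflict a-even g-odd

upper-twice : ∀ {t u} .{{_ : NonZero t}} → UpperBound t u → UpperBound (2 * t) (suc u)
upper-twice up per rf dis = cases up dis ℕₚ.m≤n⇒m≤1+n (λ a g → Conflict.bound-suc a g up dis)
  where open TwoStep per rf

upper-twice-even : ∀ {t u} .{{_ : NonZero t}} → 2 ℕ∣.∣ t → UpperBound t u → UpperBound (2 * t) u
upper-twice-even 2∣t up per rf dis = cases up dis (λ l → l) (λ a g → Conflict.bound-same a g 2∣t up dis)
  where open TwoStep per rf

-- From bounds to aw

module _ {m : ℕ} where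

  residue-ℕ : ∀ k → residue {suc m} (+ k) ≡ k mod suc m
  residue-ℕ k = toℕ-injective (mod-bounded (toℕ<n _) (toℕ<n _) (mod-trans (mod-sym (residue-sound (+ k)))
    (subst (λ r → Mod (suc m) (+ k) (+ r)) (sym (toℕ-fromℕ< (m%n<n k (suc m))))
      (congruent (divides (+ (k / suc m)) (trans (cong (λ j → + j -ᶻ + (k % suc m)) (m≡m%n+[m/n]*n k (suc m)))
        (trans (lemma (+ (k % suc m)) (+ (k / suc m * suc m))) (ℤₚ.pos-* (k / suc m) (suc m)))))))))
    where
    lemma : ∀ r q → (r +ᶻ q) -ᶻ r ≡ q
    lemma = solve-∀

  term-residue : ∀ {x y} a d k → Mod (suc m) x (+ toℕ a) → Mod (suc m) y (+ toℕ d) → residue (x +ᶻ + k *ᶻ y) ≡ term a d k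
  term-residue a d k mx my = trans (residue-cong (mod-trans (mod-+ mx (mod-* (+ k) my))
    (mod-reflexive (cong (+ toℕ a +ᶻ_) (sym (ℤₚ.pos-* k (toℕ d))))))) (residue-ℕ (toℕ a + k * toℕ d))

  upper⇒allRainbow : ∀ {u v} → UpperBound (suc m) u → u < v → AllRainbow m v
  upper⇒allRainbow {u} {v} up u<v c exact = by (any? (λ a → any? (λ d →
      ¬? (c (term a d 0) ≟ᶠ c (term a d 1)) ×-dec ¬? (c (term a d 0) ≟ᶠ c (term a d 2)) ×-dec ¬? (c (term a d 1) ≟ᶠ c (term a d 2)))))
    where
    colour : ℤ → ℕ
    colour x = toℕ (c (residue x))
    representative : Fin v → ℤ
    representative j = + toℕ (proj₁ (exact j))
    colour-representative : ∀ j → colour (representative j) ≡ toℕ j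
    colour-representative j = cong toℕ (trans (cong c (residue-toℕ (proj₁ (exact j)))) (proj₂ (exact j)))
    distinct : Distinct colour (tabulate representative)
    distinct = AllPairsₚ.tabulate⁺ (λ {i} {j} i≢j e → i≢j (toℕ-injective
      (trans (sym (colour-representative i)) (trans e (colour-representative j)))))
    Colourful : Fin (suc m) → Fin (suc m) → Set
    Colourful a d = c (term a d 0) ≢ c (term a d 1) × c (term a d 0) ≢ c (term a d 2) × c (term a d 1) ≢ c (term a d 2)
    by : Dec (∃[ a ] ∃[ d ] Colourful a d) → Rainbow3AP c
    -- A zero step or equal terms would give equal colours.
    by (yes (a , d , p , q , r)) = a , d ,
      (λ e → p (cong (λ k → c ((toℕ a + k) mod suc m)) (sym (trans (ℕₚ.+-identityʳ (toℕ d)) e)))) ,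
      ((λ e → p (cong c e)) , (λ e → q (cong c e)) , λ e → r (cong c e)) , p , q , r
    by (no none) = contradiction (subst (_≤ u) (length-tabulate representative)
        (up (λ m → cong (toℕ ∘ c) (residue-cong m)) rainbowFree distinct)) (ℕₚ.<⇒≱ u<v)
      where
      rainbowFree : RainbowFree colour
      rainbowFree x y z e = coincide (c (residue x) ≟ᶠ c (residue y)) (c (residue x) ≟ᶠ c (residue z)) (c (residue y) ≟ᶠ c (residue z))
        where
        a d : Fin (suc m)
        a = residue x
        d = residue (y -ᶻ x)
        at : ∀ k {w} → x +ᶻ + k *ᶻ (y -ᶻ x) ≡ w → c (residue w) ≡ c (term a d k)
        at k refl = cong c (term-residue a d k (residue-sound x) (residue-sound (y -ᶻ x)))
        l₀ : ∀ x y → x +ᶻ + 0 *ᶻ (y -ᶻ x) ≡ x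
        l₀ = solve-∀
        l₁ : ∀ x y → x +ᶻ + 1 *ᶻ (y -ᶻ x) ≡ y
        l₁ = solve-∀
        l₂ : ∀ x y → x +ᶻ + 2 *ᶻ (y -ᶻ x) ≡ (y +ᶻ y) -ᶻ x
        l₂ = solve-∀
        l₃ : ∀ x z → (x +ᶻ z) -ᶻ x ≡ z
        l₃ = solve-∀
        c₀ = at 0 (l₀ x y)
        c₁ = at 1 (l₁ x y)
        c₂ = at 2 (trans (l₂ x y) (trans (cong (_-ᶻ x) (sym e)) (l₃ x z)))
        coincide : Dec (c (residue x) ≡ c (residue y)) → Dec (c (residue x) ≡ c (residue z)) → Dec (c (residue y) ≡ c (residue z)) →
          Coincide (colour x) (colour y) (colour z)
        coincide (yes p) _ _ = inj₁ (cong toℕ p)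
        coincide _ (yes p) _ = inj₂ (inj₁ (cong toℕ p))
        coincide _ _ (yes p) = inj₂ (inj₂ (cong toℕ p))
        coincide (no p) (no q) (no r) = contradiction (a , d ,
          (λ s → p (trans c₀ (trans s (sym c₁)))) , (λ s → q (trans c₀ (trans s (sym c₂)))) , (λ s → r (trans c₁ (trans s (sym c₂))))) none

  -- Capping with `⊓` merges the surplus colours, which creates no rainbow progression and leaves
  -- exactly the wanted number of colours.
  lower⇒¬allRainbow : ∀ {u} → LowerBound (suc m) u → ∀ r → 1 ≤ r → r ≤ u → ¬ AllRainbow m r
  lower⇒¬allRainbow {u} l (suc r) _ r≤u rainbow = by (rainbow c′ exact)
    where
    open LowerBound l
    c′ : Fin (suc m) → Fin (suc r)
    c′ i = fromℕ< (s≤s (ℕₚ.m⊓n≤n (c (+ toℕ i)) r))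
    c′-cong : ∀ {i j} → c (+ toℕ i) ≡ c (+ toℕ j) → c′ i ≡ c′ j
    c′-cong {i} {j} e = toℕ-injective (trans (toℕ-fromℕ< _) (trans (cong (_⊓ r) e) (sym (toℕ-fromℕ< _))))
    exact : Exact c′
    exact j with onto (toℕ j) (ℕₚ.≤-trans (toℕ<n j) r≤u)
    ... | x , e = residue x , toℕ-injective (trans (toℕ-fromℕ< _) (trans (cong (_⊓ r) (trans (sym (periodic (residue-sound x))) e))
          (ℕₚ.m≤n⇒m⊓n≡m (ℕₚ.≤-pred (toℕ<n j)))))
    by : ¬ Rainbow3AP c′
    by (a , d , _ , _ , p , q , s) = clash (rainbowFree (x 0) (x 1) (x 2) (lemma (+ toℕ a) (+ toℕ d)))
      where
      x : ℕ → ℤ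
      x k = + toℕ a +ᶻ + k *ᶻ + toℕ d
      lemma : ∀ a d → (a +ᶻ + 0 *ᶻ d) +ᶻ (a +ᶻ + 2 *ᶻ d) ≡ (a +ᶻ + 1 *ᶻ d) +ᶻ (a +ᶻ + 1 *ᶻ d)
      lemma = solve-∀
      at : ∀ k → c (x k) ≡ c (+ toℕ (term a d k))
      at k = periodic (subst (λ i → Mod (suc m) (x k) (+ toℕ i)) (term-residue a d k (mod-refl (+ toℕ a)) (mod-refl (+ toℕ d))) (residue-sound (x k)))
      same : ∀ i j → c (x i) ≡ c (x j) → c′ (term a d i) ≡ c′ (term a d j)
      same i j e = c′-cong (trans (sym (at i)) (trans e (at j)))
      clash : ¬ Coincide (c (x 0)) (c (x 1)) (c (x 2))
      clash (inj₁ e)        = p (same 0 1 e)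
      clash (inj₂ (inj₁ e)) = q (same 0 2 e)
      clash (inj₂ (inj₂ e)) = s (same 1 2 e)

bounds⇒AW : ∀ {n u} .{{_ : NonZero n}} → UpperBound n u → LowerBound n u → AW n (suc u)
bounds⇒AW {suc m} up low = s≤s z≤n , upper⇒allRainbow up (ℕₚ.n<1+n _) , λ r 1≤r r<u → lower⇒¬allRainbow low r 1≤r (ℕₚ.≤-pred r<u)

AW-unique : ∀ {n v w} → AW n v → AW n w → v ≡ w
AW-unique {suc m} {v} {w} (1≤v , all-v , below-v) (1≤w , all-w , below-w) with ℕₚ.<-cmp v w
... | tri≈ _ e _ = e
... | tri< v<w _ _ = contradiction all-v (below-w v 1≤v v<w)
... | tri> _ _ w<v = contradiction all-w (below-v w 1≤w w<v)

upper-one : UpperBound 1 1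
upper-one per rf [] = z≤n
upper-one per rf {_ ∷ []} _ = ℕₚ.≤-refl
upper-one per rf {x ∷ y ∷ _} ((x≢y ∷ _) ∷ _) = contradiction (per (congruent (divides (x -ᶻ y) (sym (ℤₚ.*-identityʳ (x -ᶻ y)))))) x≢y

AW-two : AW 2 3
AW-two = bounds⇒AW (upper-twice upper-one) lower-two

module _ {p : ℕ} (pp : Prime p) (odd : Odd p) where

  private instance
    p≢0 : NonZero p
    p≢0 = prime⇒nonZero pp

  split⇒AW : Split p → AW p 4
  split⇒AW s = bounds⇒AW (at-most-three pp) (subst (λ n → LowerBound n 3) (ℕₚ.*-identityʳ p) (lower-split pp odd s lower-one))

  unsplit⇒AW : ¬ Split p → AW p 3
  unsplit⇒AW ns = bounds⇒AW (upper-unsplit pp odd ns) (subst (λ n → LowerBound n 2) (ℕₚ.*-identityʳ p) (lower-odd pp odd lower-one))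

  AW-4⇒split : AW p 4 → Split p
  AW-4⇒split aw with split? p
  ... | yes s = s
  ... | no ns with () ← AW-unique {p} aw (unsplit⇒AW ns)

  AW-3⇒unsplit : AW p 3 → ¬ Split p
  AW-3⇒unsplit aw s with () ← AW-unique {p} aw (split⇒AW s)

even-prime : ∀ {p} → Prime p → 2 ℕ∣.∣ p → p ≡ 2
even-prime pp 2∣p with prime⇒irreducible pp 2∣p
... | inj₂ e = sym e

prime-AW : ∀ p → Prime p → ∃[ v ] (AW p v × 3 ≤ v × v ≤ 4)
prime-AW p pp with 2 ℕ∣.∣? p
... | yes 2∣p = 3 , subst (λ n → AW n 3) (sym (even-prime pp 2∣p)) AW-two , ℕₚ.≤-refl , ℕₚ.n≤1+n 3
... | no odd = by (split? p)
  where
  instance _ = prime⇒nonZero pp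
  by : Dec (Split p) → ∃[ v ] (AW p v × 3 ≤ v × v ≤ 4)
  by (yes s) = 4 , split⇒AW pp odd s , ℕₚ.n≤1+n 3 , ℕₚ.≤-refl
  by (no ns) = 3 , unsplit⇒AW pp odd ns , ℕₚ.≤-refl , ℕₚ.n≤1+n 3

-- Assembling the formula from the prime factors

odd-* : ∀ {m n} → Odd m → Odd n → Odd (m * n)
odd-* {m} {n} om on d with euclidsLemma m n (from-yes (prime? 2)) d
... | inj₁ d = om d
... | inj₂ d = on d

-- k is the number of colours contributed by the odd primes. `lower` acts on an arbitrary bound, so
-- that primes are added one at a time and the power of 2 can be supplied last as the base.
record OddPart (n k : ℕ) : Set where
  field
    exponent part : ℕ
    factorisation : n ≡ 2 ^ exponent * part
    part-odd : Odd part
    upper : UpperBound part (1 + k)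
    lower : ∀ {t u} → LowerBound t u → LowerBound (part * t) (u + k)

multiply-odd : ∀ {p n k v} → Odd p → UpperBound p (suc v) → (∀ {t u} → LowerBound t u → LowerBound (p * t) (u + v)) → Prime p →
  OddPart n k → OddPart (p * n) (k + v)
multiply-odd {p} {n} {k} {v} odd up low pp o = record
  { exponent = exponent ; part = p * part
  ; factorisation = trans (cong (p *_) factorisation) (swap p (2 ^ exponent) part)
  ; part-odd = odd-* odd part-odd
  ; upper = upper-odd pp (odd-* odd part-odd) upper up
  ; lower = λ {t} {u} l → subst₂ LowerBound (sym (ℕₚ.*-assoc p part t)) (ℕₚ.+-assoc u k v) (low (lower l)) }
  where
  open OddPart o
  swap : ∀ p e m → p * (e * m) ≡ e * (p * m)
  swap = solve-ℕ

multiply-two : ∀ {n k} → OddPart n k → OddPart (2 * n) k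
multiply-two o = record
  { exponent = suc exponent ; part = part
  ; factorisation = trans (cong (2 *_) factorisation) (sym (ℕₚ.*-assoc 2 (2 ^ exponent) part))
  ; part-odd = part-odd ; upper = upper ; lower = lower }
  where open OddPart o

odd-part : ∀ {ps k₃ k₄} → All Prime ps → Count (OddAw 3) ps k₃ → Count (OddAw 4) ps k₄ → OddPart (product ps) (k₃ + 2 * k₄)
odd-part [] c-nil c-nil = record
  { exponent = 0 ; part = 1 ; factorisation = refl ; part-odd = λ d → ℕₚ.<⇒≱ ℕₚ.≤-refl (ℕ∣.∣⇒≤ d)
  ; upper = upper-one ; lower = λ {t} {u} → subst₂ LowerBound (sym (ℕₚ.*-identityˡ t)) (sym (ℕₚ.+-identityʳ u)) }
odd-part {p ∷ _} _ (c-yes (_ , aw₃) _) (c-yes (_ , aw₄) _) with () ← AW-unique {p} aw₃ aw₄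
odd-part {p ∷ ps} {suc k₃} {k₄} (pp ∷ pps) (c-yes (odd , aw) c₃) (c-no _ c₄) =
  subst (OddPart _) (ℕₚ.+-comm (k₃ + 2 * k₄) 1)
    (multiply-odd odd (upper-unsplit pp odd (AW-3⇒unsplit pp odd aw)) (lower-odd pp odd) pp (odd-part pps c₃ c₄))
odd-part {p ∷ ps} {k₃} {suc k₄} (pp ∷ pps) (c-no _ c₃) (c-yes (odd , aw) c₄) =
  subst (OddPart _) (arithmetic k₃ k₄)
    (multiply-odd odd (at-most-three pp) (lower-split pp odd (AW-4⇒split pp odd aw)) pp (odd-part pps c₃ c₄))
  where
  arithmetic : ∀ a b → a + 2 * b + 2 ≡ a + 2 * (1 + b)
  arithmetic = solve-ℕ
odd-part {p ∷ ps} {k₃} {k₄} (pp ∷ pps) (c-no n₃ c₃) (c-no n₄ c₄) with 2 ℕ∣.∣? p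
... | yes 2∣p = subst (λ q → OddPart (q * product ps) (k₃ + 2 * k₄)) (sym (even-prime pp 2∣p)) (multiply-two (odd-part pps c₃ c₄))
-- An odd prime splits or does not, so one of the two counts would have included it.
... | no odd = contradiction (λ s → n₄ (odd , split⇒AW pp odd s)) (λ ns → n₃ (odd , unsplit⇒AW pp odd ns))

f₂-even : ∀ {n} → 2 ℕ∣.∣ n → f₂ n ≡ 1
f₂-even {n} d with 2 ℕ∣.∣? n
... | yes _ = refl
... | no nd = contradiction d nd

f₂-odd : ∀ {n} → Odd n → f₂ n ≡ 0
f₂-odd {n} o with 2 ℕ∣.∣? n
... | yes d = contradiction d o
... | no _  = refl

-- The first factor 2 costs one colour; from then on the modulus is even and doubling it costs none.
upper-powers : ∀ e {m u} → .{{_ : NonZero m}} → UpperBound m u → UpperBound (2 ^ suc e * m) (suc u)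
upper-powers zero up = upper-twice up
upper-powers (suc e) {m} {u} up per rf = subst (λ n → UpperBound n (suc u)) (sym (ℕₚ.*-assoc 2 (2 ^ suc e) m))
  (upper-twice-even {{ℕₚ.m*n≢0 (2 ^ suc e) m {{ℕₚ.m^n≢0 2 (suc e)}}}} (ℕ∣.∣m⇒∣m*n m (ℕ∣.m∣m*n (2 ^ e))) (upper-powers e up)) per rf

oddPart⇒AW : ∀ {n k} → 2 ≤ n → OddPart n k → AW n (2 + f₂ n + k)
oddPart⇒AW {n} {k} 2≤n o = by exponent factorisation
  where
  open OddPart o
  instance
    n≢0 : NonZero n
    n≢0 = ≢-nonZero λ { refl → contradiction 2≤n λ () }
    part≢0 : NonZero part
    part≢0 = ≢-nonZero λ e → part-odd (subst (2 ℕ∣.∣_) (sym e) (2 ℕ∣.∣0))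
  by : ∀ e → n ≡ 2 ^ e * part → AW n (2 + f₂ n + k)
  by zero eq = subst (λ f → AW n (2 + f + k)) (sym (f₂-odd (subst Odd (sym n≡) part-odd)))
    (bounds⇒AW (subst (λ i → UpperBound i (1 + k)) (sym n≡) upper)
      (subst (λ i → LowerBound i (1 + k)) (trans (ℕₚ.*-identityʳ part) (sym n≡)) (lower lower-one)))
    where
    n≡ : n ≡ part
    n≡ = trans eq (ℕₚ.*-identityˡ part)
  by (suc e) eq = subst (λ f → AW n (2 + f + k)) (sym (f₂-even (subst (2 ℕ∣.∣_) (sym eq) (ℕ∣.∣m⇒∣m*n part (ℕ∣.m∣m*n (2 ^ e))))))
    (bounds⇒AW (subst (λ i → UpperBound i (2 + k)) (sym eq) (upper-powers e upper))
      (subst (λ i → LowerBound i (2 + k)) (trans (ℕₚ.*-comm part (2 ^ e * 2)) (trans (cong (_* part) (ℕₚ.*-comm (2 ^ e) 2)) (sym eq)))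
        -- The base is the colouring by parity, read modulo 2^(e + 1).
        (lower (lower-multiple (2 ^ e) lower-two))))

-- Primes below 100

mod-*-cong : ∀ {n x y a b} → Mod n x y → Mod n a b → Mod n (x *ᶻ a) (y *ᶻ b)
mod-*-cong {n} {x} {y} {a} {b} p q = mod-trans (mod-* x q) (subst₂ (Mod n) (ℤₚ.*-comm b x) (ℤₚ.*-comm b y) (mod-* b p))

mod-^ : ∀ {n x y} m → Mod n x y → Mod n (x ^ᶻ m) (y ^ᶻ m)
mod-^ zero _ = mod-refl (+ 1)
mod-^ (suc m) d = mod-*-cong d (mod-^ m d)

*-^ : ∀ x y m → (x *ᶻ y) ^ᶻ m ≡ x ^ᶻ m *ᶻ y ^ᶻ m
*-^ x y zero = refl
*-^ x y (suc m) = trans (cong (x *ᶻ y *ᶻ_) (*-^ x y m)) (lemma x y (x ^ᶻ m) (y ^ᶻ m))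
  where
  lemma : ∀ x y a b → (x *ᶻ y) *ᶻ (a *ᶻ b) ≡ (x *ᶻ a) *ᶻ (y *ᶻ b)
  lemma = solve-∀

-- x ↦ x^{2m} is invariant under negation, and under doubling if 4^m ≡ 1.
power-split : ∀ {p} m b → Prime p → Mod p ((+ 4) ^ᶻ m) (+ 1) → ¬ + p ∣ᶻ b → ¬ Mod p (+ 1) ((b *ᶻ b) ^ᶻ m) → Split p
power-split {p} m b pp 4^m p∤b 1≢b = record
  { f = f ; periodic = λ d → cong toℕ (residue-cong (mod-^ m (mod-*-cong d d)))
  ; neg = λ x → cong (λ w → toℕ (residue {p} (w ^ᶻ m))) (lemma x)
  ; twofold = λ x → cong toℕ (residue-cong (mod-trans (mod-reflexive (trans (cong (_^ᶻ m) (lemma′ x)) (*-^ (+ 4) (x *ᶻ x) m)))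
      (subst (Mod p ((+ 4) ^ᶻ m *ᶻ (x *ᶻ x) ^ᶻ m)) (ℤₚ.*-identityˡ ((x *ᶻ x) ^ᶻ m)) (mod-*-cong 4^m (mod-refl ((x *ᶻ x) ^ᶻ m))))))
  ; a = + 1 ; b = b ; p∤a = λ d → nonTrivial⇒≢1 (ℕ∣.∣1⇒≡1 (∣⇒∣ᵤ d)) ; p∤b = p∤b
  ; separate = λ e → 1≢b (mod-trans (mod-reflexive (sym (ℤₚ.^-zeroˡ m))) (mod-trans (residue-sound ((+ 1 *ᶻ + 1) ^ᶻ m)) (mod-trans (mod-reflexive (cong +_ e)) (mod-sym (residue-sound ((b *ᶻ b) ^ᶻ m)))))) }
  where
  instance
    _ = prime⇒nonZero pp
    _ = prime⇒nonTrivial pp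
  f : ℤ → ℕ
  f x = toℕ (residue {p} ((x *ᶻ x) ^ᶻ m))
  lemma : ∀ x → (-ᶻ x) *ᶻ (-ᶻ x) ≡ x *ᶻ x
  lemma = solve-∀
  lemma′ : ∀ x → (x +ᶻ x) *ᶻ (x +ᶻ x) ≡ + 4 *ᶻ (x *ᶻ x)
  lemma′ = solve-∀

-- i is congruent to 2^k or -2^k for some k < p. In natural numbers the first congruence includes i
-- ≤ 2^k, as `∸` truncates.
Reached : ℕ → ℕ → Set
Reached p i = ∃[ k ] (p ℕ∣.∣ 2 ^ toℕ {p} k ∸ i × i ≤ 2 ^ toℕ {p} k ⊎ p ℕ∣.∣ 2 ^ toℕ {p} k + i)

reached? : ∀ p → Decidable (Reached p)
reached? p i = any? (λ k → ((p ℕ∣.∣? (2 ^ toℕ k ∸ i)) ×-dec (i ≤? 2 ^ toℕ k)) ⊎-dec (p ℕ∣.∣? (2 ^ toℕ k + i)))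

Generated : ℕ → Set
Generated p = ∀ (i : Fin p) → toℕ i ≡ 0 ⊎ Reached p (toℕ i)

generated? : ∀ p → Dec (Generated p)
generated? p = all? (λ i → (toℕ i ≟ 0) ⊎-dec reached? p (toℕ i))

-- ±2^k runs through all nonzero residues, so an invariant function is constant on them.
generated⇒unsplit : ∀ {p} .{{_ : NonZero p}} → Generated p → ¬ Split p
generated⇒unsplit {p} gen s = separate (trans (constant p∤a) (sym (constant p∤b)))
  where
  open Split s
  power : ∀ k → f (+ (2 ^ k)) ≡ f (+ 1)
  power zero = refl
  power (suc k) = trans (cong (λ n → f (+ (2 ^ k + n))) (ℕₚ.+-identityʳ (2 ^ k))) (trans (twofold (+ (2 ^ k))) (power k))
  positive : ∀ {i} k → i ≤ 2 ^ k → p ℕ∣.∣ 2 ^ k ∸ i → f (+ i) ≡ f (+ 1)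
  positive {i} k i≤ d = trans (sym (periodic (congruent (subst (+ p ∣ᶻ_)
    (sym (trans (ℤₚ.[+m]-[+n]≡m⊖n (2 ^ k) i) (ℤₚ.⊖-≥ i≤))) (∣ᵤ⇒∣ {+ p} {+ (2 ^ k ∸ i)} d))))) (power k)
  negative : ∀ {i} k → p ℕ∣.∣ 2 ^ k + i → f (+ i) ≡ f (+ 1)
  negative {i} k d = trans (sym (trans (periodic (congruent (subst (+ p ∣ᶻ_) (lemma (+ (2 ^ k)) (+ i))
    (∣ᵤ⇒∣ {+ p} {+ (2 ^ k + i)} d)))) (neg (+ i)))) (power k)
    where
    lemma : ∀ x i → x +ᶻ i ≡ x -ᶻ (-ᶻ i)
    lemma = solve-∀
  constant : ∀ {x} → ¬ + p ∣ᶻ x → f x ≡ f (+ 1)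
  constant {x} p∤x with gen (residue x)
  ... | inj₁ i≡0 = contradiction (mod-∣ (residue-sound x) (subst (λ i → + p ∣ᶻ + i) (sym i≡0) (divides (+ 0) refl))) p∤x
  ... | inj₂ (k , inj₁ (d , i≤)) = trans (periodic (residue-sound x)) (positive (toℕ k) i≤ d)
  ... | inj₂ (k , inj₂ d) = trans (periodic (residue-sound x)) (negative (toℕ k) d)

Q₃ : List ℕ
Q₃ = 3 ∷ 5 ∷ 7 ∷ 11 ∷ 13 ∷ 19 ∷ 23 ∷ 29 ∷ 37 ∷ 47 ∷ 53 ∷ 59 ∷ 61 ∷ 67 ∷ 71 ∷ 79 ∷ 83 ∷ []

abstract
  Q₃-generated : All Generated Q₃
  Q₃-generated = from-yes (All.all? generated? Q₃)

  -- Sieve of Eratosthenes: a composite number below 100 has a prime factor at most 7.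
  below-100 : ∀ (i : Fin 100) → (toℕ i ≤ 2 ⊎ toℕ i ∈ Q₃ ⊎ toℕ i ∈ Q₄) ⊎
    Any (λ d → d ℕ∣.∣ toℕ i × d ≢ 1 × d ≢ toℕ i) (2 ∷ 3 ∷ 5 ∷ 7 ∷ [])
  below-100 = from-yes (all? {100} (λ i → ((toℕ i ≤? 2) ⊎-dec (toℕ i ∈? Q₃) ⊎-dec (toℕ i ∈? Q₄)) ⊎-dec
    anyᴸ? (λ d → (d ℕ∣.∣? toℕ i) ×-dec ¬? (d ≟ 1) ×-dec ¬? (d ≟ toℕ i)) (2 ∷ 3 ∷ 5 ∷ 7 ∷ [])))

odd-prime-below-100 : ∀ {p} → Prime p → Odd p → p < 100 → p ∉ Q₄ → p ∈ Q₃
odd-prime-below-100 {p} pp odd p<100 p∉Q₄ = by (subst (λ n → (n ≤ 2 ⊎ n ∈ Q₃ ⊎ n ∈ Q₄) ⊎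
    Any (λ d → d ℕ∣.∣ n × d ≢ 1 × d ≢ n) (2 ∷ 3 ∷ 5 ∷ 7 ∷ [])) (toℕ-fromℕ< p<100) (below-100 (fromℕ< p<100)))
  where
  instance _ = prime⇒nonTrivial pp
  by : (p ≤ 2 ⊎ p ∈ Q₃ ⊎ p ∈ Q₄) ⊎ Any (λ d → d ℕ∣.∣ p × d ≢ 1 × d ≢ p) (2 ∷ 3 ∷ 5 ∷ 7 ∷ []) → p ∈ Q₃
  by (inj₁ (inj₁ p≤2)) = contradiction (subst (2 ℕ∣.∣_) (ℕₚ.≤-antisym (nonTrivial⇒n>1 p) p≤2) ℕ∣.∣-refl) odd
  by (inj₁ (inj₂ (inj₁ p∈Q₃))) = p∈Q₃
  by (inj₁ (inj₂ (inj₂ p∈Q₄))) = contradiction p∈Q₄ p∉Q₄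
  by (inj₂ any) with satisfied any
  ... | d , d∣p , d≢1 , d≢p with prime⇒irreducible pp d∣p
  ... | inj₁ e = contradiction e d≢1
  ... | inj₂ e = contradiction e d≢p

unsplit-below-100 : ∀ {p} → Prime p → Odd p → p < 100 → p ∉ Q₄ → ¬ Split p
unsplit-below-100 pp odd p<100 p∉Q₄ = generated⇒unsplit (All.lookup Q₃-generated (odd-prime-below-100 pp odd p<100 p∉Q₄))
  where instance _ = prime⇒nonZero pp

-- The exponent m is half the order of the group generated by −1 and 2, and b lies outside that group.
PowerSplit : ℕ → ℕ → ℕ → Set
PowerSplit p m b = + p ∣ᶻ (+ 4) ^ᶻ m -ᶻ + 1 × ¬ + p ∣ᶻ + b × ¬ + p ∣ᶻ + 1 -ᶻ (+ b *ᶻ + b) ^ᶻ m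

powerSplit? : ∀ p m b → Dec (PowerSplit p m b)
powerSplit? p m b = (_ ∣ᶻ? _) ×-dec ¬? (_ ∣ᶻ? _) ×-dec ¬? (_ ∣ᶻ? _)

powerSplit⇒split : ∀ {p} m b → Prime p → PowerSplit p m b → Split p
powerSplit⇒split m b pp (d , p∤b , 1≢b) = power-split m (+ b) pp (congruent d) p∤b (λ q → 1≢b (Mod.difference q))

Q₄⇒split : ∀ {p} → Prime p → p ∈ Q₄ → Split p
Q₄⇒split pp (here refl) = powerSplit⇒split 4 3 pp (from-yes (powerSplit? 17 4 3))
Q₄⇒split pp (there (here refl)) = powerSplit⇒split 5 3 pp (from-yes (powerSplit? 31 5 3))
Q₄⇒split pp (there (there (here refl))) = powerSplit⇒split 10 3 pp (from-yes (powerSplit? 41 10 3))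
Q₄⇒split pp (there (there (there (here refl)))) = powerSplit⇒split 7 3 pp (from-yes (powerSplit? 43 7 3))
Q₄⇒split pp (there (there (there (there (here refl))))) = powerSplit⇒split 9 3 pp (from-yes (powerSplit? 73 9 3))
Q₄⇒split pp (there (there (there (there (there (here refl)))))) = powerSplit⇒split 11 3 pp (from-yes (powerSplit? 89 11 3))
Q₄⇒split pp (there (there (there (there (there (there (here refl))))))) = powerSplit⇒split 24 5 pp (from-yes (powerSplit? 97 24 5))

-- Both implications enter, since `c-no` carries a refutation.
count-map : ∀ {P Q R : ℕ → Set} → (∀ {x} → R x → P x → Q x) → (∀ {x} → R x → Q x → P x) →
  ∀ {xs k} → All R xs → Count P xs k → Count Q xs k
count-map to from [] c-nil = c-nil
count-map to from (r ∷ rs) (c-yes p c) = c-yes (to r p) (count-map to from rs c)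
count-map to from (r ∷ rs) (c-no np c) = c-no (λ q → np (from r q)) (count-map to from rs c)

theorem1p6 :
    (∀ p → Prime p → ∃[ v ] (AW p v × 3 ≤ v × v ≤ 4))
    ×
    (∀ n → 2 ≤ n → (fs : PrimeFactorisation n) → ∀ k₃ k₄ →
      Count (OddAw 3) (factors fs) k₃ → Count (OddAw 4) (factors fs) k₄ →
      AW n (2 + f₂ n + k₃ + 2 * k₄))
    ×
    (∀ n → 2 ≤ n → (fs : PrimeFactorisation n) → All (λ p → p < 100) (factors fs) →
      ∀ k₃ k₄ → Count (OddAw 3) (factors fs) k₃ → Count (OddAw 4) (factors fs) k₄ →
      Count InQ₄ (factors fs) k₄ × Count InQ₃ (factors fs) k₃)
theorem1p6 = prime-AW , formula , small-factors
  where
  open PrimeFactorisation using (isFactorisation; factorsPrime)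
  formula : ∀ n → 2 ≤ n → (fs : PrimeFactorisation n) → ∀ k₃ k₄ →
    Count (OddAw 3) (factors fs) k₃ → Count (OddAw 4) (factors fs) k₄ → AW n (2 + f₂ n + k₃ + 2 * k₄)
  formula n 2≤n fs k₃ k₄ c₃ c₄ = subst (AW n) (sym (ℕₚ.+-assoc (2 + f₂ n) k₃ (2 * k₄)))
    (oddPart⇒AW 2≤n (subst (λ m → OddPart m (k₃ + 2 * k₄)) (sym (isFactorisation fs)) (odd-part (factorsPrime fs) c₃ c₄)))
  Small : ℕ → Set
  Small p = Prime p × p < 100
  to₄ : ∀ {p} → Small p → OddAw 4 p → InQ₄ p
  to₄ {p} (pp , p<100) (odd , aw) with p ∈? Q₄
  ... | yes p∈Q₄ = odd , p∈Q₄
  ... | no p∉Q₄ = contradiction (AW-4⇒split pp odd aw) (unsplit-below-100 pp odd p<100 p∉Q₄)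
  from₄ : ∀ {p} → Small p → InQ₄ p → OddAw 4 p
  from₄ (pp , _) (odd , p∈Q₄) = odd , split⇒AW pp odd (Q₄⇒split pp p∈Q₄)
  to₃ : ∀ {p} → Small p → OddAw 3 p → InQ₃ p
  to₃ (pp , p<100) (odd , aw) = odd , pp , p<100 , λ p∈Q₄ → AW-3⇒unsplit pp odd aw (Q₄⇒split pp p∈Q₄)
  from₃ : ∀ {p} → Small p → InQ₃ p → OddAw 3 p
  from₃ (pp , p<100) (odd , _ , _ , p∉Q₄) = odd , unsplit⇒AW pp odd (unsplit-below-100 pp odd p<100 p∉Q₄)
  small-factors : ∀ n → 2 ≤ n → (fs : PrimeFactorisation n) → All (λ p → p < 100) (factors fs) →
    ∀ k₃ k₄ → Count (OddAw 3) (factors fs) k₃ → Count (OddAw 4) (factors fs) k₄ →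
    Count InQ₄ (factors fs) k₄ × Count InQ₃ (factors fs) k₃
  small-factors n _ fs below k₃ k₄ c₃ c₄ = count-map to₄ from₄ small c₄ , count-map to₃ from₃ small c₃
    where
    small : All Small (factors fs)
    small = All.zip (factorsPrime fs , below)
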